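{- Let $A,B,C,D,E$ be the following trees on the vertex set $\{1,2,\dots,7\}$: $A$ has edges $12,23,34,45,56,27$; $B$ has edges $12,23,34,45,56,37$; $C$ has edges $12,23,34,45,26,37$; $D$ has edges $12,23,34,45,36,67$; $E$ has edges $12,23,34,45,26,47$. Then $R(T,W_8)=13$ for each $T\in\{A,B,C\}$, $R(D,W_8)=14$ and $R(E,W_8)=15$.
   Context: All graphs are finite and simple. For graphs $G,H$, the Ramsey number $R(G,H)$ is the smallest integer $N$ such that for every graph $F$ of order $N$, either $F$ contains $G$ as a subgraph or the complement $\overline{F}$ contains $H$ as a subgraph. $W_m$ denotes the wheel of order $m+1$, obtained by joining one vertex (the hub) to every vertex of a cycle $C_m$; thus $W_8$ has 9 vertices. -}

module Defs where

open import Data.Nat using (ℕ; zero; suc; _<_; _≡ᵇ_)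
open import Data.Fin using (Fin; toℕ; zero; suc)
open import Data.Fin.Properties using (_≟_)
open import Data.Bool using (Bool; true; false; _∧_; _∨_; not; if_then_else_)
open import Data.Bool.Properties using (∨-comm)
open import Data.List using (List; []; _∷_)
open import Data.Product using (Σ; _×_; _,_)
open import Data.Sum using (_⊎_)
open import Relation.Nullary using (¬_; Dec; yes; no)
open import Relation.Binary.PropositionalEquality using (_≡_; refl; cong₂)
open import Function.Definitions using (Injective)

record Graph (n : ℕ) : Set where
  field
    adj    : Fin n → Fin n → Bool
    sym    : ∀ i j → adj i j ≡ adj j i
    irrefl : ∀ i → adj i i ≡ false

open Graph public

Edge : ∀ {n} → Graph n → Fin n → Fin n → Set
Edge G i j = adj G i j ≡ true

complement : ∀ {n} → Graph n → Graph n
complement {n} G = record { adj = a ; sym = s ; irrefl = r }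
  where
  a : Fin n → Fin n → Bool
  a i j with i ≟ j
  ... | yes _ = false
  ... | no  _ = not (adj G i j)
  s : ∀ i j → a i j ≡ a j i
  s i j with i ≟ j | j ≟ i
  ... | yes _ | yes _ = refl
  ... | yes p | no q = Data.Empty.⊥-elim (q (Relation.Binary.PropositionalEquality.sym p))
    where import Data.Empty
  ... | no p | yes q = Data.Empty.⊥-elim (p (Relation.Binary.PropositionalEquality.sym q))
    where import Data.Empty
  ... | no _ | no _ = Relation.Binary.PropositionalEquality.cong not (sym G i j)
  r : ∀ i → a i i ≡ false
  r i with i ≟ i
  ... | yes _ = refl
  ... | no p = Data.Empty.⊥-elim (p refl)
    where import Data.Empty

_⊆ᴳ_ : ∀ {m n} → Graph m → Graph n → Set
_⊆ᴳ_ {m} {n} G F =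
  Σ (Fin m → Fin n) λ f →
    Injective _≡_ _≡_ f × (∀ i j → Edge G i j → Edge F (f i) (f j))

Arrows : ℕ → ∀ {m k} → Graph m → Graph k → Set
Arrows N G H = (F : Graph N) → (G ⊆ᴳ F) ⊎ (H ⊆ᴳ complement F)

RamseyNumberIs : ∀ {m k} → Graph m → Graph k → ℕ → Set
RamseyNumberIs G H N = Arrows N G H × (∀ M → M < N → ¬ Arrows M G H)

-- Graphs from edge lists, vertices labelled 1..n (label k ↔ Fin index k-1).

lbl : ∀ {n} → Fin n → ℕ
lbl i = suc (toℕ i)

hasEdge : ∀ {n} → List (ℕ × ℕ) → Fin n → Fin n → Bool
hasEdge [] i j = false
hasEdge ((a , b) ∷ es) i j =
  ((lbl i ≡ᵇ a) ∧ (lbl j ≡ᵇ b)) ∨ ((lbl i ≡ᵇ b) ∧ (lbl j ≡ᵇ a)) ∨ hasEdge es i j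

hasEdge-sym : ∀ {n} es (i j : Fin n) → hasEdge es i j ≡ hasEdge es j i
hasEdge-sym [] i j = refl
hasEdge-sym ((a , b) ∷ es) i j =
  Relation.Binary.PropositionalEquality.trans
    (Relation.Binary.PropositionalEquality.cong₂ _∨_
       (Data.Bool.Properties.∧-comm (lbl i ≡ᵇ a) (lbl j ≡ᵇ b))
       (Relation.Binary.PropositionalEquality.cong₂ _∨_
          (Data.Bool.Properties.∧-comm (lbl i ≡ᵇ b) (lbl j ≡ᵇ a))
          (hasEdge-sym es i j)))
    (swap3 ((lbl j ≡ᵇ b) ∧ (lbl i ≡ᵇ a)) ((lbl j ≡ᵇ a) ∧ (lbl i ≡ᵇ b)) (hasEdge es j i))
  where
  import Data.Bool.Properties
  import Relation.Binary.PropositionalEquality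
  swap3 : ∀ x y z → x ∨ y ∨ z ≡ y ∨ x ∨ z
  swap3 false false z = refl
  swap3 false true z = refl
  swap3 true false z = refl
  swap3 true true z = refl

fromEdges : (n : ℕ) (es : List (ℕ × ℕ)) → (∀ i → hasEdge {n} es i i ≡ false) → Graph n
fromEdges n es r = record { adj = hasEdge es ; sym = hasEdge-sym es ; irrefl = r }

treeA : Graph 7
treeA = fromEdges 7 ((1 , 2) ∷ (2 , 3) ∷ (3 , 4) ∷ (4 , 5) ∷ (5 , 6) ∷ (2 , 7) ∷ []) r
  where r : ∀ i → _
        r zero = refl
        r (suc zero) = refl
        r (suc (suc zero)) = refl
        r (suc (suc (suc zero))) = refl
        r (suc (suc (suc (suc zero)))) = refl
        r (suc (suc (suc (suc (suc zero))))) = refl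
        r (suc (suc (suc (suc (suc (suc zero)))))) = refl

treeB : Graph 7
treeB = fromEdges 7 ((1 , 2) ∷ (2 , 3) ∷ (3 , 4) ∷ (4 , 5) ∷ (5 , 6) ∷ (3 , 7) ∷ []) r
  where r : ∀ i → _
        r zero = refl
        r (suc zero) = refl
        r (suc (suc zero)) = refl
        r (suc (suc (suc zero))) = refl
        r (suc (suc (suc (suc zero)))) = refl
        r (suc (suc (suc (suc (suc zero))))) = refl
        r (suc (suc (suc (suc (suc (suc zero)))))) = refl

treeC : Graph 7
treeC = fromEdges 7 ((1 , 2) ∷ (2 , 3) ∷ (3 , 4) ∷ (4 , 5) ∷ (2 , 6) ∷ (3 , 7) ∷ []) r
  where r : ∀ i → _
        r zero = refl
        r (suc zero) = refl
        r (suc (suc zero)) = refl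
        r (suc (suc (suc zero))) = refl
        r (suc (suc (suc (suc zero)))) = refl
        r (suc (suc (suc (suc (suc zero))))) = refl
        r (suc (suc (suc (suc (suc (suc zero)))))) = refl

treeD : Graph 7
treeD = fromEdges 7 ((1 , 2) ∷ (2 , 3) ∷ (3 , 4) ∷ (4 , 5) ∷ (3 , 6) ∷ (6 , 7) ∷ []) r
  where r : ∀ i → _
        r zero = refl
        r (suc zero) = refl
        r (suc (suc zero)) = refl
        r (suc (suc (suc zero))) = refl
        r (suc (suc (suc (suc zero)))) = refl
        r (suc (suc (suc (suc (suc zero))))) = refl
        r (suc (suc (suc (suc (suc (suc zero)))))) = refl

treeE : Graph 7
treeE = fromEdges 7 ((1 , 2) ∷ (2 , 3) ∷ (3 , 4) ∷ (4 , 5) ∷ (2 , 6) ∷ (4 , 7) ∷ []) r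
  where r : ∀ i → _
        r zero = refl
        r (suc zero) = refl
        r (suc (suc zero)) = refl
        r (suc (suc (suc zero))) = refl
        r (suc (suc (suc (suc zero)))) = refl
        r (suc (suc (suc (suc (suc zero))))) = refl
        r (suc (suc (suc (suc (suc (suc zero)))))) = refl

wheel8 : Graph 9
wheel8 = fromEdges 9
  ((1 , 2) ∷ (2 , 3) ∷ (3 , 4) ∷ (4 , 5) ∷ (5 , 6) ∷ (6 , 7) ∷ (7 , 8) ∷ (8 , 1) ∷
   (9 , 1) ∷ (9 , 2) ∷ (9 , 3) ∷ (9 , 4) ∷ (9 , 5) ∷ (9 , 6) ∷ (9 , 7) ∷ (9 , 8) ∷ []) r
  where r : ∀ i → _
        r zero = refl
        r (suc zero) = refl
        r (suc (suc zero)) = refl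
        r (suc (suc (suc zero))) = refl
        r (suc (suc (suc (suc zero)))) = refl
        r (suc (suc (suc (suc (suc zero))))) = refl
        r (suc (suc (suc (suc (suc (suc zero)))))) = refl
        r (suc (suc (suc (suc (suc (suc (suc zero))))))) = refl
        r (suc (suc (suc (suc (suc (suc (suc (suc zero)))))))) = refl

{-# OPTIONS --safe #-}

-- Upper bounds.  Let F have 10 + d vertices, where d = 3 for A, B, C, d = 4 for D and d = 5 for E, and
-- suppose that F contains no copy of the tree T.  On any ten vertices the complement of F contains C₈: a
-- path in it can be prolonged up to eight vertices and then rearranged into a cycle.  Hence a vertex with
-- ten non-neighbours is the hub of a W₈ in the complement, and we may assume that F has minimum degree d.
-- Then a component with more than six vertices contains some tree on seven vertices other than the path,
-- and each of these forces T.  So all components have at most six vertices, there are at least three of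
-- them, and a hub in the first together with four vertices in each of two others, visited alternately,
-- is a W₈ in the complement.
--
-- Lower bounds.  The extremal graphs are 2K₆ for A, B, C, K₆ together with two K₄ sharing a vertex for D,
-- and K₆ ∪ K₄,₄ for E.
module Submission where

open import Defs hiding (sym)
open import Data.Bool using (Bool; true; false; _∧_; _∨_; not; if_then_else_; T)
open import Data.Bool.ListAction using (any; all)
open import Data.Bool.Properties as Bool using (T-∧; T-∨)
open import Data.Empty using (⊥-elim)
open import Data.Fin using (Fin; zero; suc; toℕ; inject≤)
open import Data.Fin.Properties using (_≟_; toℕ<n; toℕ-injective; injective⇒≤; inject≤-injective; any?)
open import Data.List
  using (List; []; _∷_; map; _++_; length; upTo; allFin; filter; concatMap; lookup)
import Data.List.Membership.DecPropositional as DecMembership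
open import Data.List.Membership.Propositional using (_∈_; _∉_; find)
open import Data.List.Membership.Propositional.Properties
  using (∈-map⁺; ∈-map⁻; ∈-upTo⁺; ∈-upTo⁻; ∈-++⁺ˡ; ∈-++⁺ʳ; ∈-filter⁺; ∈-filter⁻; ∈-allFin; ∈-lookup)
open import Data.List.Membership.Setoid.Properties using (index-injective)
open import Data.List.Properties using (length-map; length-upTo; length-++)
open import Data.List.Relation.Binary.Subset.Propositional using (_⊆_)
open import Data.List.Relation.Unary.All as All using (All; []; _∷_)
import Data.List.Relation.Unary.All.Properties as Allₚ
open import Data.List.Relation.Unary.AllPairs as AllPairs using (AllPairs; []; _∷_)
import Data.List.Relation.Unary.AllPairs.Properties as AllPairsₚ
open import Data.List.Relation.Unary.Any as Any using (here; there; index)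
open import Data.List.Relation.Unary.Any.Properties using (any⁻)
open import Data.List.Relation.Unary.Unique.Propositional using (Unique)
open import Data.Nat
  using (ℕ; zero; suc; pred; _+_; _∸_; _/_; _%_; _≤_; _<_; z≤n; s≤s; s≤s⁻¹; _≡ᵇ_; _<ᵇ_)
open import Data.Nat.Properties hiding (_≟_)
open import Data.Product using (Σ; ∃; _×_; _,_; proj₁; proj₂)
open import Data.Sum using (_⊎_; inj₁; inj₂; map₁)
open import Data.Vec as Vec using (replicate)
open import Function using (_∘_; id; const)
open import Function.Bundles using (Equivalence)
open import Function.Definitions using (Injective)
open import Relation.Binary.PropositionalEquality
  using (_≡_; _≢_; refl; sym; trans; cong; cong₂; subst; setoid)
open import Relation.Nullary using (¬_; yes; no; does)
open import Relation.Nullary.Decidable using (¬?; _×-dec_; decidable-stable)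
open import Relation.Nullary.Negation using (contradiction)

-- The number ten cannot be lowered: K₆ ∪ K₃ has nine vertices and contains no tree on seven
-- vertices, while its complement K₆,₃ has no C₈. The values of d are forced by large components
-- that avoid the tree. Two K₄ sharing a vertex have minimum degree 3 and seven vertices but contain
-- no D, and K₄,₄ has minimum degree 4 but contains no E. Hence D needs d = 4 and E needs d = 5.
-- Graphs on 13 to 15 vertices are too many to enumerate. A case analysis therefore carries only the
-- adjacencies that it has asked for, and is stored as a tree whose correctness is a Boolean
-- computation with a soundness proof done once. The degree bound is itself a consequence of the
-- search for C₈ around a hub, so that search has to run without any assumption on degrees. Nothing
-- is assumed to be free of T. Each hypothesis about F instead has a second alternative, which
-- delivers the desired copy at once.

∧⁻ : ∀ {x y} → T (x ∧ y) → T x × T y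
∧⁻ = Equivalence.to T-∧

∨⁻ : ∀ {x y} → T (x ∨ y) → T x ⊎ T y
∨⁻ = Equivalence.to T-∨

-- Case analyses on an unknown graph and their Boolean checker

-- (i , j , b) prescribes the adjacency b between the i-th and the j-th chosen vertex.
Fact : Set
Fact = ℕ × ℕ × Bool

Pattern : Set
Pattern = ℕ × List Fact

-- A case distinction on an unknown graph, of which k vertices (numbered 0 … k-1) and some
-- adjacencies are known:
--   embed t w   the t-th pattern has been found; hexadecimal digit i of w, counted from the
--               right, is the image of its vertex i;
--   split i j   branches on whether i and j are adjacent;
--   grow i      vertex i still lacks neighbours, so it has one outside the known vertices;
--   exit cs     some edge leaves the set of known vertices, and cs has a branch for each
--               possible inner end; the outer end becomes vertex k.
data Certificate : Set where
  embed : (t w : ℕ) → Certificate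
  split : (i j : ℕ) (adjacent nonadjacent : Certificate) → Certificate
  grow  : (i : ℕ) → Certificate → Certificate
  exit  : List Certificate → Certificate

sameFact : Fact → Fact → Bool
sameFact (i , j , b) (i′ , j′ , b′) =
  (((i ≡ᵇ i′) ∧ (j ≡ᵇ j′)) ∨ ((i ≡ᵇ j′) ∧ (j ≡ᵇ i′))) ∧ (if b then b′ else not b′)

knows : List Fact → Fact → Bool
knows Γ φ = any (sameFact φ) Γ

digits : ℕ → ℕ → List ℕ
digits zero    w = []
digits (suc n) w = w % 16 ∷ digits n (w / 16)

distinct : List ℕ → Bool
distinct []       = true
distinct (x ∷ xs) = all (λ y → not (x ≡ᵇ y)) xs ∧ distinct xs

nth : ∀ {A : Set} → A → List A → ℕ → A
nth d []       _       = d
nth d (x ∷ xs) zero    = x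
nth d (x ∷ xs) (suc i) = nth d xs i

embeds : ℕ → List Fact → Pattern → List ℕ → Bool
embeds k Γ (m , Δ) vs = all (_<ᵇ k) vs ∧ distinct vs ∧ all here? Δ
  where
  here? : Fact → Bool
  here? (i , j , b) = (i <ᵇ m) ∧ (j <ᵇ m) ∧ knows Γ (nth 0 vs i , nth 0 vs j , b)

neighbours : ℕ → List Fact → ℕ → List ℕ
neighbours zero    Γ i = []
neighbours (suc k) Γ i =
  if knows Γ (i , k , true) then k ∷ neighbours k Γ i else neighbours k Γ i

settled : List Fact → ℕ → List ℕ → ℕ → Bool
settled Γ i ns j = (i ≡ᵇ j) ∨ any (j ≡ᵇ_) ns ∨ knows Γ (i , j , false)

-- A neighbour of i outside the list `ns` is a new vertex only if every known vertex is i itself, a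
-- member of `ns` or a known non-neighbour of i. Hence the test of `settled` on all of `upTo k`.
growable : ℕ → ℕ → List Fact → ℕ → List ℕ → Bool
growable d k Γ i ns = (i <ᵇ k) ∧ (length ns <ᵇ d) ∧ all (settled Γ i ns) (upTo k)

patternAt : List Pattern → ℕ → Pattern
patternAt = nth (0 , [])

-- Here d is a lower bound on degrees, and sets of fewer than e known vertices are left by an edge.
-- With d = 0 no `grow` passes the check and with e = 0 no `exit` does, so one checker serves
-- analyses with and without these hypotheses.
module _ (d e : ℕ) (table : List Pattern) (targets : List ℕ) where

  embedded : ℕ → List Fact → Pattern → ℕ → Bool
  embedded k Γ π w = embeds k Γ π (digits (proj₁ π) w)

  mutual
    check : ℕ → List Fact → Certificate → Bool
    check k Γ (embed t w)   = any (t ≡ᵇ_) targets ∧ embedded k Γ (patternAt table t) w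
    check k Γ (split i j c c′) =
      (i <ᵇ k) ∧ (j <ᵇ k) ∧ check k ((i , j , true) ∷ Γ) c ∧ check k ((i , j , false) ∷ Γ) c′
    check k Γ (grow i c)    =
      growable d k Γ i (neighbours k Γ i) ∧ check (suc k) ((i , k , true) ∷ Γ) c
    check k Γ (exit cs)     = (k <ᵇ e) ∧ checkFrom 0 k Γ cs

    checkFrom : ℕ → ℕ → List Fact → List Certificate → Bool
    -- The list has to run out exactly at k, so that every known vertex has its branch.
    checkFrom i k Γ []       = i ≡ᵇ k
    checkFrom i k Γ (c ∷ cs) = (i <ᵇ k) ∧ check (suc k) ((i , k , true) ∷ Γ) c ∧ checkFrom (suc i) k Γ cs

-- Assignments of vertices to numbers

nth-∈ : ∀ {A : Set} (d : A) {xs i} → i < length xs → nth d xs i ∈ xs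
nth-∈ d {x ∷ xs} {zero}  _         = here refl
nth-∈ d {x ∷ xs} {suc i} (s≤s i<n) = there (nth-∈ d i<n)

not-≡ᵇ : ∀ {m n} → T (not (m ≡ᵇ n)) → m ≢ n
not-≡ᵇ {m} {n} p m≡n with m ≡ᵇ n in eq
... | false = subst T eq (≡⇒≡ᵇ m n m≡n)

nth-injective : ∀ xs → T (distinct xs) → ∀ {i j} → i < length xs → j < length xs →
                nth 0 xs i ≡ nth 0 xs j → i ≡ j
nth-injective (x ∷ xs) ds {zero}  {zero}  _ _ _ = refl
nth-injective (x ∷ xs) ds {zero}  {suc j} _ (s≤s j<n) eq =
  contradiction eq (not-≡ᵇ (All.lookup (Allₚ.all⁺ (λ y → not (x ≡ᵇ y)) xs (proj₁ (∧⁻ ds))) (nth-∈ 0 j<n)))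
nth-injective (x ∷ xs) ds {suc i} {zero}  (s≤s i<n) _ eq =
  contradiction (sym eq) (not-≡ᵇ (All.lookup (Allₚ.all⁺ (λ y → not (x ≡ᵇ y)) xs (proj₁ (∧⁻ ds))) (nth-∈ 0 i<n)))
nth-injective (x ∷ xs) ds {suc i} {suc j} (s≤s i<n) (s≤s j<n) eq =
  cong suc (nth-injective xs (proj₂ (∧⁻ {all (λ y → not (x ≡ᵇ y)) xs} ds)) i<n j<n eq)

length-digits : ∀ n w → length (digits n w) ≡ n
length-digits zero    w = refl
length-digits (suc n) w = cong suc (length-digits n (w / 16))

any-≡ᵇ : ∀ {n} xs → T (any (n ≡ᵇ_) xs) → n ∈ xs
any-≡ᵇ {n} xs p = Any.map (≡ᵇ⇒≡ n _) (any⁻ _ xs p)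

-- Assignments are total functions on ℕ of which only the values below k matter; their type then
-- stays the same when further vertices become known.
InjectiveBelow : ∀ {A : Set} → ℕ → (ℕ → A) → Set
InjectiveBelow k f = ∀ {i j} → i < k → j < k → f i ≡ f j → i ≡ j

extend : ∀ {A : Set} → (ℕ → A) → ℕ → A → ℕ → A
extend f k y n = if n ≡ᵇ k then y else f n

extend-new : ∀ {A : Set} (f : ℕ → A) k y → extend f k y k ≡ y
extend-new f k y with k ≡ᵇ k in eq
... | true  = refl
... | false = ⊥-elim (subst T eq (≡⇒≡ᵇ k k refl))

extend-old : ∀ {A : Set} (f : ℕ → A) {k} y {n} → n < k → extend f k y n ≡ f n
extend-old f {k} y {n} n<k with n ≡ᵇ k in eq
... | true  = contradiction (≡ᵇ⇒≡ n k (subst T (sym eq) _)) (<⇒≢ n<k)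
... | false = refl

image : ∀ {A : Set} → ℕ → (ℕ → A) → List A
image k f = map f (upTo k)

∈-image : ∀ {A : Set} {f : ℕ → A} {k i} → i < k → f i ∈ image k f
∈-image {f = f} i<k = ∈-map⁺ f (∈-upTo⁺ i<k)

length-image : ∀ {A : Set} k (f : ℕ → A) → length (image k f) ≡ k
length-image k f = trans (length-map f (upTo k)) (length-upTo k)

extend-injective : ∀ {A : Set} (f : ℕ → A) k {y} → InjectiveBelow k f → y ∉ image k f →
                   InjectiveBelow (suc k) (extend f k y)
extend-injective f k {y} inj y∉ {i} {j} i< j< eq
  with m<1+n⇒m<n∨m≡n i< | m<1+n⇒m<n∨m≡n j<
... | inj₁ i<k  | inj₁ j<k  = inj i<k j<k
                                (trans (sym (extend-old f y i<k)) (trans eq (extend-old f y j<k)))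
... | inj₂ refl | inj₂ refl = refl
... | inj₁ i<k  | inj₂ refl = ⊥-elim (y∉ (subst (_∈ image k f)
                                (trans (sym (extend-old f y i<k)) (trans eq (extend-new f k y))) (∈-image i<k)))
... | inj₂ refl | inj₁ j<k  = ⊥-elim (y∉ (subst (_∈ image k f)
                                (trans (sym (extend-old f y j<k)) (trans (sym eq) (extend-new f k y))) (∈-image j<k)))

image-extend : ∀ {A : Set} (f : ℕ → A) k y → image k f ⊆ image (suc k) (extend f k y)
image-extend f k y x∈ with i , i∈ , refl ← ∈-map⁻ f x∈ =
  subst (_∈ image (suc k) (extend f k y)) (extend-old f y (∈-upTo⁻ i∈)) (∈-image (m<n⇒m<1+n (∈-upTo⁻ i∈)))

-- Soundness of the checker

module Soundness {N : ℕ} (F : Graph N) where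

  V : Set
  V = Fin N

  Holds : ℕ → (ℕ → V) → Fact → Set
  Holds k f (i , j , b) = i < k × j < k × adj F (f i) (f j) ≡ b

  Occurs : Pattern → Set
  Occurs (k , Γ) = Σ (ℕ → V) λ f → InjectiveBelow k f × All (Holds k f) Γ

  holds-extend : ∀ {f k φ} y → Holds k f φ → Holds (suc k) (extend f k y) φ
  holds-extend {f} {k} y (i<k , j<k , eq) =
    m<n⇒m<1+n i<k , m<n⇒m<1+n j<k ,
    trans (cong₂ (adj F) (extend-old f y i<k) (extend-old f y j<k)) eq

  sameFact-sound : ∀ {f k} φ ψ → T (sameFact φ ψ) → Holds k f ψ → Holds k f φ
  sameFact-sound (i , j , b) (i′ , j′ , b′) p (i′< , j′< , eq)
    with p₁ , p₂ ← ∧⁻ {((i ≡ᵇ i′) ∧ (j ≡ᵇ j′)) ∨ ((i ≡ᵇ j′) ∧ (j ≡ᵇ i′))} p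
    with same b b′ p₂ | ∨⁻ {(i ≡ᵇ i′) ∧ (j ≡ᵇ j′)} p₁
    where
    same : ∀ b b′ → T (if b then b′ else not b′) → b ≡ b′
    same true  true  _ = refl
    same false false _ = refl
  ... | refl | inj₁ q with q₁ , q₂ ← ∧⁻ {i ≡ᵇ i′} q
                      with refl ← ≡ᵇ⇒≡ i i′ q₁ | refl ← ≡ᵇ⇒≡ j j′ q₂ = i′< , j′< , eq
  ... | refl | inj₂ q with q₁ , q₂ ← ∧⁻ {i ≡ᵇ j′} q
                      with refl ← ≡ᵇ⇒≡ i j′ q₁ | refl ← ≡ᵇ⇒≡ j i′ q₂ =
                      j′< , i′< , trans (Graph.sym F _ _) eq

  knows-sound : ∀ {f k} Γ φ → All (Holds k f) Γ → T (knows Γ φ) → Holds k f φ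
  knows-sound Γ φ hΓ p with ψ , ψ∈ , q ← find (any⁻ (sameFact φ) Γ p) =
    sameFact-sound φ ψ q (All.lookup hΓ ψ∈)

  embeds-sound : ∀ {f k} Γ m Δ vs → length vs ≡ m → InjectiveBelow k f → All (Holds k f) Γ →
                 T (embeds k Γ (m , Δ) vs) → Occurs (m , Δ)
  embeds-sound {f} {k} Γ m Δ vs refl inj hΓ p
    with p₁ , p₂₃ ← ∧⁻ {all (_<ᵇ k) vs} p
    with p₂ , p₃ ← ∧⁻ {distinct vs} p₂₃ =
    -- The default 0 of `nth` is met only at arguments from m on, where an occurrence demands
    -- nothing.
    f ∘ nth 0 vs ,
    (λ i< j< eq → nth-injective vs p₂ i< j< (inj (below i<) (below j<) eq)) ,
    All.map found (Allₚ.all⁺ _ Δ p₃)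
    where
    below : ∀ {i} → i < length vs → nth 0 vs i < k
    below i< = <ᵇ⇒< _ _ (All.lookup (Allₚ.all⁺ (_<ᵇ k) vs p₁) (nth-∈ 0 i<))
    found : ∀ {φ} → _ → Holds m (f ∘ nth 0 vs) φ
    found {i , j , b} q with q₁ , q₂₃ ← ∧⁻ {i <ᵇ m} q
                        with q₂ , q₃ ← ∧⁻ {j <ᵇ m} q₂₃ =
      <ᵇ⇒< _ _ q₁ , <ᵇ⇒< _ _ q₂ , proj₂ (proj₂ (knows-sound {f} Γ _ hΓ q₃))

  neighbours-known : ∀ k Γ i {j} → j ∈ neighbours k Γ i → T (knows Γ (i , j , true))
  neighbours-known (suc k) Γ i j∈ with knows Γ (i , k , true) in eq | j∈
  ... | true  | here refl = subst T (sym eq) _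
  ... | true  | there j∈′ = neighbours-known k Γ i j∈′
  ... | false | j∈′       = neighbours-known k Γ i j∈′

  -- Avoiding any list shorter than d expresses minimum degree d without counting.
  MinDegree : ℕ → Set → Set
  MinDegree d P = ∀ x L → length L < d → P ⊎ ∃ λ y → Edge F x y × y ∉ L

  Leaves : List V → Set
  Leaves L = ∃ λ x → ∃ λ y → x ∈ L × y ∉ L × Edge F x y

  edge-irrefl : ∀ {x} → ¬ Edge F x x
  edge-irrefl {x} p with () ← trans (sym p) (irrefl F x)

  -- The known vertices always include `base`. Thus `leave` may answer with P when the known
  -- vertices form a closed set, and that set is then sure to contain the vertex from which the
  -- analysis started.
  module _ {d e : ℕ} {table : List Pattern} {targets : List ℕ} {P : Set}
           (found : ∀ {t} → t ∈ targets → Occurs (patternAt table t) → P)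
           (minDegree : MinDegree d P)
           (base : List V)
           (leave : ∀ L → length L < e → base ⊆ L → P ⊎ Leaves L) where

    Known : ℕ → (ℕ → V) → List Fact → Set
    Known k f Γ = InjectiveBelow k f × All (Holds k f) Γ × base ⊆ image k f

    known-extend : ∀ {k f Γ i y} → Known k f Γ → i < k → y ∉ image k f → Edge F (f i) y →
                   Known (suc k) (extend f k y) ((i , k , true) ∷ Γ)
    known-extend {k} {f} {Γ} {i} {y} (inj , hΓ , b⊆) i<k y∉ iy =
      extend-injective f k inj y∉ ,
      (m<n⇒m<1+n i<k , n<1+n k , trans (cong₂ (adj F) (extend-old f y i<k) (extend-new f k y)) iy)
        ∷ All.map (holds-extend {f} y) hΓ ,
      image-extend f k y ∘ b⊆

    mutual
      sound : ∀ {k f Γ} c → T (check d e table targets k Γ c) → Known k f Γ → P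
      sound {k} {f} {Γ} (embed t w) p (inj , hΓ , _)
        with p₁ , p₂ ← ∧⁻ {any (t ≡ᵇ_) targets} p =
        found {t} (any-≡ᵇ targets p₁)
          (embeds-sound Γ m Δ (digits m w) (length-digits m w) inj hΓ p₂)
        where
        m = proj₁ (patternAt table t)
        Δ = proj₂ (patternAt table t)
      sound {k} {f} {Γ} (split i j c c′) p (inj , hΓ , b⊆)
        with p₁ , p₂₃₄ ← ∧⁻ {i <ᵇ k} p
        with p₂ , p₃₄ ← ∧⁻ {j <ᵇ k} p₂₃₄
        with p₃ , p₄ ← ∧⁻ {check d e table targets k ((i , j , true) ∷ Γ) c} p₃₄
        with adj F (f i) (f j) in eq
      ... | true  = sound c  p₃ (inj , (<ᵇ⇒< _ _ p₁ , <ᵇ⇒< _ _ p₂ , eq) ∷ hΓ , b⊆)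
      ... | false = sound c′ p₄ (inj , (<ᵇ⇒< _ _ p₁ , <ᵇ⇒< _ _ p₂ , eq) ∷ hΓ , b⊆)
      sound {k} {f} {Γ} (grow i c) p known@(inj , hΓ , b⊆)
        with p₁₂₃ , q ← ∧⁻ {growable d k Γ i (neighbours k Γ i)} p
        with p₁ , p₂₃ ← ∧⁻ {i <ᵇ k} p₁₂₃
        with p₂ , p₃ ← ∧⁻ {length (neighbours k Γ i) <ᵇ d} p₂₃
        with minDegree (f i) (map f (neighbours k Γ i))
               (subst (_< d) (sym (length-map f (neighbours k Γ i))) (<ᵇ⇒< _ _ p₂))
      ... | inj₁ done = done
      ... | inj₂ (y , iy , y∉) = sound c q (known-extend known (<ᵇ⇒< _ _ p₁) y-new iy)
        where
        -- If y were the known vertex j, the three cases of `settled` would give a loop at `f i`, a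
        -- vertex on the avoided list, or an edge to a known non-neighbour.
        y-new : y ∉ image k f
        y-new y∈ with j , j∈ , refl ← ∈-map⁻ f y∈
                 with ∨⁻ {i ≡ᵇ j} (All.lookup (Allₚ.all⁺ _ (upTo k) p₃) j∈)
        ... | inj₁ i≡j with refl ← ≡ᵇ⇒≡ i j i≡j = edge-irrefl iy
        ... | inj₂ r with ∨⁻ {any (j ≡ᵇ_) (neighbours k Γ i)} r
        ...   | inj₁ r₁ = y∉ (∈-map⁺ f (any-≡ᵇ (neighbours k Γ i) r₁))
        ...   | inj₂ r₂ with () ← trans (sym iy) (proj₂ (proj₂ (knows-sound {f} Γ _ hΓ r₂)))
      sound {k} {f} {Γ} (exit cs) p known@(inj , hΓ , b⊆)
        with p₁ , p₂ ← ∧⁻ {k <ᵇ e} p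
        with leave (image k f) (subst (_< e) (sym (length-image k f)) (<ᵇ⇒< _ _ p₁)) b⊆
      ... | inj₁ done = done
      ... | inj₂ (x , y , x∈ , y∉ , xy) with i , i∈ , refl ← ∈-map⁻ f x∈ =
        soundFrom cs p₂ known z≤n (∈-upTo⁻ i∈) y∉ xy

      -- Here j counts the branches passed over. The inner end i of the edge is still ahead because
      -- j ≤ i, and the list can end only at j = k > i, so the branch for i is reached.
      soundFrom : ∀ {j k f Γ i y} cs → T (checkFrom d e table targets j k Γ cs) → Known k f Γ →
                  j ≤ i → i < k → y ∉ image k f → Edge F (f i) y → P
      soundFrom {j} {k} [] p known j≤i i<k y∉ iy with refl ← ≡ᵇ⇒≡ j k p =
        contradiction j≤i (<⇒≱ i<k)
      soundFrom {j} {k} {f} {Γ} (c ∷ cs) p known j≤i i<k y∉ iy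
        with p₁ , p₂₃ ← ∧⁻ {j <ᵇ k} p
        with p₂ , p₃ ← ∧⁻ {check d e table targets (suc k) ((j , k , true) ∷ Γ) c} p₂₃
        with m≤n⇒m<n∨m≡n j≤i
      ... | inj₁ j<i  = soundFrom cs p₃ known j<i i<k y∉ iy
      ... | inj₂ refl = sound c p₂ (known-extend known i<k y∉ iy)

-- Patterns and certificates of the upper bounds

-- A pattern is resolved if its occurrence yields one of the initial targets; it may then serve as a
-- target itself.
resolves : ℕ → List Pattern → List ℕ → List (ℕ × Certificate) → Bool
resolves d table ts []            = true
resolves d table ts ((t , c) ∷ s) =
  check d 0 table ts (proj₁ (patternAt table t)) (proj₂ (patternAt table t)) c ∧
  resolves d table (t ∷ ts) s

resolved : List ℕ → List (ℕ × Certificate) → List ℕ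
resolved ts []            = ts
resolved ts ((t , _) ∷ s) = resolved (t ∷ ts) s

-- Edge lists number the vertices from 1, as `hasEdge` does, and patterns number them from 0; hence
-- `pred`.
prescribe : Bool → ℕ → List (ℕ × ℕ) → Pattern
prescribe b n es = n , map (λ (x , y) → pred x , pred y , b) es

-- Vertex 10 is a hub nonadjacent to 0, …, 9, of which the first suc k are consecutive
-- along a path in the complement.
hubPath : ℕ → Pattern
hubPath k = 11 , map (λ i → 10 , i , false) (upTo 10) ++ map (λ i → i , suc i , false) (upTo k)

row : ℕ → List Fact
row i = map (λ j → i , 4 + j , false) (upTo 4)

cross : List Fact
cross = concatMap row (upTo 4)

-- The complement of K₁ ∪ K₄,₄, with vertex 8 as K₁.
hubBipartite : Pattern
hubBipartite = 9 , cross ++ map (λ i → i , 8 , false) (upTo 8)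

wheelEdges : List (ℕ × ℕ)
wheelEdges =
  (1 , 2) ∷ (2 , 3) ∷ (3 , 4) ∷ (4 , 5) ∷ (5 , 6) ∷ (6 , 7) ∷ (7 , 8) ∷ (8 , 1) ∷
  (9 , 1) ∷ (9 , 2) ∷ (9 , 3) ∷ (9 , 4) ∷ (9 , 5) ∷ (9 , 6) ∷ (9 , 7) ∷ (9 , 8) ∷ []

-- The path, having maximum degree 2, is not needed.
shapes : List Pattern
shapes = map (prescribe true 7)
  ( ((1 , 2) ∷ (1 , 3) ∷ (1 , 4) ∷ (1 , 5) ∷ (1 , 6) ∷ (1 , 7) ∷ [])
  ∷ ((1 , 2) ∷ (1 , 3) ∷ (1 , 4) ∷ (1 , 5) ∷ (1 , 6) ∷ (2 , 7) ∷ [])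
  ∷ ((1 , 2) ∷ (1 , 3) ∷ (1 , 4) ∷ (1 , 5) ∷ (2 , 6) ∷ (2 , 7) ∷ [])
  ∷ ((1 , 2) ∷ (1 , 3) ∷ (1 , 4) ∷ (1 , 5) ∷ (2 , 6) ∷ (3 , 7) ∷ [])
  ∷ ((1 , 2) ∷ (1 , 3) ∷ (1 , 4) ∷ (1 , 5) ∷ (2 , 6) ∷ (6 , 7) ∷ [])
  ∷ ((1 , 2) ∷ (1 , 3) ∷ (1 , 4) ∷ (2 , 5) ∷ (2 , 6) ∷ (3 , 7) ∷ [])
  ∷ ((1 , 2) ∷ (1 , 3) ∷ (1 , 4) ∷ (2 , 5) ∷ (3 , 6) ∷ (4 , 7) ∷ [])
  ∷ ((1 , 2) ∷ (1 , 3) ∷ (1 , 4) ∷ (2 , 5) ∷ (3 , 6) ∷ (5 , 7) ∷ [])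
  ∷ ((1 , 2) ∷ (1 , 3) ∷ (1 , 4) ∷ (2 , 5) ∷ (5 , 6) ∷ (5 , 7) ∷ [])
  ∷ ((1 , 2) ∷ (1 , 3) ∷ (1 , 4) ∷ (2 , 5) ∷ (5 , 6) ∷ (6 , 7) ∷ [])
  ∷ [])

-- In sparseTable the tree has index 0, hubPath k index 1 + k, the wheel index 9 and hubBipartite index 10.
sparseTable denseTable : List (ℕ × ℕ) → List Pattern
sparseTable es =
  prescribe true 7 es ∷ map hubPath (upTo 8) ++ prescribe false 9 wheelEdges ∷ hubBipartite ∷ []
denseTable  es = prescribe true 7 es ∷ shapes

all-map : ∀ {A : Set} {P : A → Set} n (φ : ℕ → A) → (∀ {i} → i < n → P (φ i)) →
          All P (map φ (upTo n))
all-map n φ p = Allₚ.map⁺ (Allₚ.applyUpTo⁺₁ id n p)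

-- `sparse` reduces ten non-neighbours of a vertex (index 1) and `hubBipartite` (index 10) to the
-- tree or the wheel; `dense` reduces the seven-vertex shapes to the tree under minimum degree d;
-- `exhaust` enlarges a single vertex to one of those shapes. For concrete data the Boolean fields
-- compute to the unit type, so giving the three certificates determines the record.
record Certified (es : List (ℕ × ℕ)) (d : ℕ) : Set where
  field
    sparse             : List (ℕ × Certificate)
    dense              : List (ℕ × Certificate)
    exhaust            : Certificate
    sparse-ok          : T (resolves 0 (sparseTable es) (0 ∷ 9 ∷ []) sparse)
    hub-resolved       : T (any (1 ≡ᵇ_) (resolved (0 ∷ 9 ∷ []) sparse))
    bipartite-resolved : T (any (10 ≡ᵇ_) (resolved (0 ∷ 9 ∷ []) sparse))
    dense-ok           : T (resolves d (denseTable es) (0 ∷ []) dense)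
    exhaust-ok         : T (check d 7 (denseTable es) (resolved (0 ∷ []) dense) 1 [] exhaust)

-- Choosing and combining distinct vertices

module _ {N : ℕ} where
  open DecMembership (_≟_ {N}) using (_∈?_)

  -- Pigeonhole: if every vertex occurred in L, its position in L would be an injection of `Fin N`
  -- into `Fin (length L)`.
  fresh : (L : List (Fin N)) → length L < N → ∃ λ z → z ∉ L
  fresh L L<N with any? (λ z → ¬? (z ∈? L))
  ... | yes p = p
  ... | no ¬p = contradiction (injective⇒≤ (index-injective (setoid _) (member _) (member _))) (<⇒≱ L<N)
    where
    member : ∀ z → z ∈ L
    member z = decidable-stable (z ∈? L) (λ z∉ → ¬p (z , z∉))

  avoiding : Fin N → (L : List (Fin N)) → ∀ m → m + length L ≤ N →
             ∃ λ f → InjectiveBelow m f × (∀ {i} → i < m → f i ∉ L)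
  -- The vertex x only fills in values at arguments from m on.
  avoiding x L zero    _ = const x , (λ ()) , λ ()
  avoiding x L (suc m) h
    with f , inj , f∉ ← avoiding x L m (<⇒≤ h)
    with z , z∉ ← fresh (image m f ++ L)
           (subst (_< N) (sym (trans (length-++ (image m f)) (cong (_+ length L) (length-image m f)))) h) =
    extend f m z , extend-injective f m inj (z∉ ∘ ∈-++⁺ˡ) , outside
    where
    outside : ∀ {i} → i < suc m → extend f m z i ∉ L
    outside i< with m<1+n⇒m<n∨m≡n i<
    ... | inj₁ i<m  = subst (_∉ L) (sym (extend-old f z i<m)) (f∉ i<m)
    ... | inj₂ refl = subst (_∉ L) (sym (extend-new f m z)) (z∉ ∘ ∈-++⁺ʳ (image m f))

join : ∀ {A : Set} → ℕ → (ℕ → A) → (ℕ → A) → ℕ → A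
join a f g n = if n <ᵇ a then f n else g (n ∸ a)

module _ {A : Set} (a : ℕ) (f g : ℕ → A) where

  join-< : ∀ {n} → n < a → join a f g n ≡ f n
  join-< {n} n<a with n <ᵇ a in eq
  ... | true  = refl
  ... | false = ⊥-elim (subst T eq (<⇒<ᵇ n<a))

  join-≥ : ∀ {n} → a ≤ n → join a f g n ≡ g (n ∸ a)
  join-≥ {n} a≤n with n <ᵇ a in eq
  ... | true  = contradiction (<ᵇ⇒< n a (subst T (sym eq) _)) (≤⇒≯ a≤n)
  ... | false = refl

  ∸-< : ∀ {b n} → a ≤ n → n < a + b → n ∸ a < b
  ∸-< {b} a≤n n< = +-cancelˡ-< a _ _ (subst (_< a + b) (sym (m+[n∸m]≡n a≤n)) n<)

  join-injective : ∀ {b} → InjectiveBelow a f → InjectiveBelow b g →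
                   (∀ {i j} → i < a → j < b → f i ≢ g j) → InjectiveBelow (a + b) (join a f g)
  join-injective {b} injf injg f≢g {i} {j} i< j< eq with <-≤-connex i a | <-≤-connex j a
  ... | inj₁ i<a | inj₁ j<a = injf i<a j<a (trans (sym (join-< i<a)) (trans eq (join-< j<a)))
  ... | inj₁ i<a | inj₂ a≤j =
    contradiction (trans (sym (join-< i<a)) (trans eq (join-≥ a≤j))) (f≢g i<a (∸-< a≤j j<))
  ... | inj₂ a≤i | inj₁ j<a =
    contradiction (trans (sym (join-< j<a)) (trans (sym eq) (join-≥ a≤i))) (f≢g j<a (∸-< a≤i i<))
  ... | inj₂ a≤i | inj₂ a≤j = ∸-cancelʳ-≡ a≤i a≤j (injg (∸-< a≤i i<) (∸-< a≤j j<)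
                                (trans (sym (join-≥ a≤i)) (trans eq (join-≥ a≤j))))

-- The upper bound for a certified tree

module Upper {d : ℕ} {es : List (ℕ × ℕ)} (cert : Certified es d) (3≤d : 3 ≤ d) (F : Graph (10 + d)) where
  open Certified cert
  open Soundness F
  open DecMembership (_≟_ {10 + d}) using (_∈?_)

  Goal : Set
  Goal = Occurs (prescribe true 7 es) ⊎ Occurs (prescribe false 9 wheelEdges)

  resolves-sound : ∀ {P : Set} {d table ts} s → MinDegree d P →
    (∀ {t} → t ∈ ts → Occurs (patternAt table t) → P) → T (resolves d table ts s) →
    ∀ {t} → t ∈ resolved ts s → Occurs (patternAt table t) → P
  resolves-sound []            deg found ok = found
  resolves-sound {P} {d} {table} {ts} ((t , c) ∷ s) deg found ok
    with ok₁ , ok₂ ← ∧⁻ {check d 0 table ts (proj₁ (patternAt table t)) (proj₂ (patternAt table t)) c} ok =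
    resolves-sound s deg found′ ok₂
    where
    found′ : ∀ {u} → u ∈ t ∷ ts → Occurs (patternAt table u) → P
    found′ (here refl) (f , inj , holds) =
      -- With e = 0 the hypothesis on leaving edges is vacuous, and `base` can be empty.
      sound {table = table} {targets = ts} found deg [] (λ _ ()) c ok₁ (inj , holds , λ ())
    found′ (there u∈)  = found u∈

  -- Minimum degree 0 is vacuous, so this holds for every F and can be used to establish
  -- `minDegree`.
  sparse-sound : ∀ {t} → t ∈ resolved (0 ∷ 9 ∷ []) sparse → Occurs (patternAt (sparseTable es) t) → Goal
  sparse-sound = resolves-sound sparse (λ _ _ ()) found sparse-ok
    where
    found : ∀ {t} → t ∈ 0 ∷ 9 ∷ [] → Occurs (patternAt (sparseTable es) t) → Goal
    found (here refl)         = inj₁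
    found (there (here refl)) = inj₂

  non-edge : ∀ {x y} → ¬ Edge F x y → adj F x y ≡ false
  non-edge = Bool.¬-not

  -- The path in `hubPath 0` is a single vertex, so ten distinct non-neighbours of one vertex
  -- suffice.
  hub-found : Occurs (hubPath 0) → Goal
  hub-found = sparse-sound {1} (any-≡ᵇ (resolved (0 ∷ 9 ∷ []) sparse) hub-resolved)

  bipartite-found : Occurs hubBipartite → Goal
  bipartite-found = sparse-sound {10} (any-≡ᵇ (resolved (0 ∷ 9 ∷ []) sparse) bipartite-resolved)

  hub : ∀ x f → InjectiveBelow 10 f → (∀ {i} → i < 10 → x ≢ f i) →
        (∀ {i} → i < 10 → adj F x (f i) ≡ false) → Occurs (hubPath 0)
  hub x f inj x≢ x≁ = g , extend-injective f 10 inj x∉ , all-map {P = Holds 11 g} 10 (λ i → 10 , i , false) spoke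
    where
    g : ℕ → V
    g = extend f 10 x
    x∉ : x ∉ image 10 f
    x∉ x∈ with i , i∈ , x≡ ← ∈-map⁻ f x∈ = x≢ (∈-upTo⁻ i∈) x≡
    spoke : ∀ {i} → i < 10 → Holds 11 g (10 , i , false)
    spoke {i} i< = ≤-refl , m<n⇒m<1+n i< ,
      trans (cong₂ (adj F) (extend-new f 10 x) (extend-old f x i<)) (x≁ i<)

  -- If all neighbours of x lie in L, then outside x ∷ L, which has length at most d, there remain
  -- ten of the 10 + d vertices, and x is a hub for them.
  minDegree : MinDegree d Goal
  minDegree x L L<d with any? (λ y → (adj F x y Bool.≟ true) ×-dec ¬? (y ∈? L))
  ... | yes p = inj₂ p
  ... | no ¬p = inj₁ (isolate (avoiding x (x ∷ L) 10 (+-monoʳ-≤ 10 L<d)))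
    where
    isolate : (∃ λ f → InjectiveBelow 10 f × (∀ {i} → i < 10 → f i ∉ x ∷ L)) → Goal
    isolate (f , inj , f∉) = hub-found (hub x f inj (λ i< x≡ → f∉ i< (here (sym x≡)))
      (λ {i} i< → non-edge (λ e → ¬p (f i , e , f∉ i< ∘ there))))

  Closed : List V → Set
  Closed L = ∀ {x y} → x ∈ L → Edge F x y → y ∈ L

  -- A closed list is a union of components; it serves in place of the component of v, and being
  -- closed is what rules out edges to the outside.
  SmallComponent : V → Set
  SmallComponent v = ∃ λ L → length L < 7 × v ∈ L × Closed L

  -- The known vertices grow from v alone. At each `exit` either an edge leaves them or they are
  -- closed, and the latter, with fewer than seven of them, is the second alternative. With seven
  -- vertices one of the shapes has appeared.
  component : ∀ v → Goal ⊎ SmallComponent v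
  component v = sound {table = denseTable es} {targets = resolved (0 ∷ []) dense}
                  found deg (v ∷ []) leave {f = const v} exhaust exhaust-ok (inj , [] , λ { (here refl) → here refl })
    where
    inj : InjectiveBelow 1 (const v)
    inj (s≤s z≤n) (s≤s z≤n) _ = refl
    found₀ : ∀ {t} → t ∈ 0 ∷ [] → Occurs (patternAt (denseTable es) t) → Goal
    found₀ (here refl) = inj₁
    found : ∀ {t} → t ∈ resolved (0 ∷ []) dense → Occurs (patternAt (denseTable es) t) →
            Goal ⊎ SmallComponent v
    found t∈ o = inj₁ (resolves-sound dense minDegree found₀ dense-ok t∈ o)
    deg : MinDegree d (Goal ⊎ SmallComponent v)
    deg x L L<d = map₁ inj₁ (minDegree x L L<d)
    leave : ∀ L → length L < 7 → v ∷ [] ⊆ L → (Goal ⊎ SmallComponent v) ⊎ Leaves L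
    leave L L<7 v∈ with any? (λ x → any? (λ y → (x ∈? L) ×-dec ¬? (y ∈? L) ×-dec (adj F x y Bool.≟ true)))
    ... | yes p = inj₂ p
    ... | no ¬p = inj₁ (inj₂ (L , L<7 , v∈ (here refl) ,
                    λ {x} {y} x∈ e → decidable-stable (y ∈? L) (λ y∉ → ¬p (x , y , x∈ , y∉ , e))))

  edge-sym : ∀ {x y} → Edge F x y → Edge F y x
  edge-sym = trans (Graph.sym F _ _)

  -- Vertices near v lie on the same side of every closed list as v does. Four of them can thus
  -- stand for the component of v without the component being listed.
  Near : V → V → Set
  Near v x = x ≡ v ⊎ Edge F v x

  near-inside : ∀ {L v x} → Closed L → v ∈ L → Near v x → x ∈ L
  near-inside cl v∈ (inj₁ refl) = v∈
  near-inside cl v∈ (inj₂ e)    = cl v∈ e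

  near-outside : ∀ {L v x} → Closed L → v ∉ L → Near v x → x ∉ L
  near-outside cl v∉ (inj₁ refl) = v∉
  near-outside cl v∉ (inj₂ e) x∈ = v∉ (cl x∈ (edge-sym e))

  Star : ℕ → V → Set
  Star m v = ∃ λ f → InjectiveBelow m f × (∀ {i} → i < m → Near v (f i))

  -- `minDegree` is applied m times, each time avoiding the neighbours found before.
  leaves : ∀ m v → m ≤ d → Goal ⊎ ∃ λ f → InjectiveBelow m f × (∀ {i} → i < m → Edge F v (f i))
  leaves zero    v _ = inj₂ (const v , (λ ()) , λ ())
  leaves (suc m) v m<d with leaves m v (<⇒≤ m<d)
  ... | inj₁ goal = inj₁ goal
  ... | inj₂ (f , inj , vf) with minDegree v (image m f) (subst (_< d) (sym (length-image m f)) m<d)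
  ...   | inj₁ goal = inj₁ goal
  ...   | inj₂ (y , vy , y∉) = inj₂ (extend f m y , extend-injective f m inj y∉ , edges)
    where
    edges : ∀ {i} → i < suc m → Edge F v (extend f m y i)
    edges i< with m<1+n⇒m<n∨m≡n i<
    ... | inj₁ i<m  = subst (Edge F v) (sym (extend-old f y i<m)) (vf i<m)
    ... | inj₂ refl = subst (Edge F v) (sym (extend-new f m y)) vy

  -- Three neighbours, available because 3 ≤ d, and v itself as the fourth vertex.
  star : ∀ v → Goal ⊎ Star 4 v
  star v with leaves 3 v 3≤d
  ... | inj₁ goal = inj₁ goal
  ... | inj₂ (f , inj , vf) = inj₂ (extend f 3 v , extend-injective f 3 inj v∉ , near)
    where
    v∉ : v ∉ image 3 f
    v∉ v∈ with i , i∈ , v≡ ← ∈-map⁻ f v∈ = edge-irrefl (subst (Edge F v) (sym v≡) (vf (∈-upTo⁻ i∈)))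
    near : ∀ {i} → i < 4 → Near v (extend f 3 v i)
    near i< with m<1+n⇒m<n∨m≡n i<
    ... | inj₁ i<3  = inj₂ (subst (Edge F v) (sym (extend-old f v i<3)) (vf i<3))
    ... | inj₂ refl = inj₁ (extend-new f 3 v)

  -- L and M witness that v, x and y lie in three different components.
  assemble : ∀ {v x y L M} → Closed L → v ∈ L → Closed M → x ∉ L → x ∈ M → y ∉ L → y ∉ M →
             Star 4 x → Star 4 y → Goal
  assemble {v} {x} {y} {L} {M} clL v∈L clM x∉L x∈M y∉L y∉M (f , injf , nf) (g , injg , ng) =
    bipartite-found (h ,
      join-injective 4 f k injf (join-injective 4 g (const v) injg inj₁₁ gv) fgv ,
      Allₚ.++⁺ (Allₚ.concat⁺ (all-map 4 row λ {i} i< → all-map 4 (λ j → i , 4 + j , false) (crossing i<)))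
               (all-map 8 (λ i → i , 8 , false) spoke))
    where
    -- In the numbering of `hubBipartite`, the vertices 0 to 3 are near x, 4 to 7 are near y, and 8
    -- is v.
    k : ℕ → V
    k = join 4 g (const v)
    h : ℕ → V
    h = join 4 f k
    inj₁₁ : InjectiveBelow 1 (const v)
    inj₁₁ (s≤s z≤n) (s≤s z≤n) _ = refl
    f∈M : ∀ {i} → i < 4 → f i ∈ M
    f∈M i< = near-inside clM x∈M (nf i<)
    f∉L : ∀ {i} → i < 4 → f i ∉ L
    f∉L i< = near-outside clL x∉L (nf i<)
    g∉M : ∀ {i} → i < 4 → g i ∉ M
    g∉M i< = near-outside clM y∉M (ng i<)
    g∉L : ∀ {i} → i < 4 → g i ∉ L
    g∉L i< = near-outside clL y∉L (ng i<)
    gv : ∀ {i j} → i < 4 → j < 1 → g i ≢ v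
    gv i< _ eq = g∉L i< (subst (_∈ L) (sym eq) v∈L)
    fgv : ∀ {i j} → i < 4 → j < 5 → f i ≢ k j
    fgv {i} {j} i< j< eq with <-≤-connex j 4
    ... | inj₁ j<4 = g∉M j<4 (subst (_∈ M) (trans eq (join-< 4 g (const v) j<4)) (f∈M i<))
    ... | inj₂ 4≤j = f∉L i< (subst (_∈ L) (sym (trans eq (join-≥ 4 g (const v) 4≤j))) v∈L)
    crossing : ∀ {i} → i < 4 → ∀ {j} → j < 4 → Holds 9 h (i , 4 + j , false)
    crossing {i} i< {j} j< = ≤-trans i< (m≤m+n 4 5) , +-monoʳ-< 4 (m<n⇒m<1+n j<) ,
      trans (cong₂ (adj F) (join-< 4 f k i<) (trans (join-≥ 4 f k (m≤m+n 4 j)) (join-< 4 g (const v) j<)))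
            (non-edge (λ e → g∉M j< (clM (f∈M i<) e)))
    spoke : ∀ {i} → i < 8 → Holds 9 h (i , 8 , false)
    spoke {i} i< = m<n⇒m<1+n i< , ≤-refl , non-edge (λ e → h∉L (clL v∈L (edge-sym e)))
      where
      h∉L : h i ∉ L
      h∉L with <-≤-connex i 4
      ... | inj₁ i<4 = subst (_∉ L) (sym (join-< 4 f k i<4)) (f∉L i<4)
      ... | inj₂ 4≤i = subst (_∉ L) (sym (trans (join-≥ 4 f k 4≤i) (join-< 4 g (const v) i-4<))) (g∉L i-4<)
        where
        i-4< = ∸-< 4 f g 4≤i i<

  goal : Goal
  goal with component zero
  ... | inj₁ g = g
  ... | inj₂ (L , L<7 , v∈L , clL) with fresh L (≤-trans L<7 (m≤m+n 7 (3 + d)))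
  ... | x , x∉L with component x | star x
  ... | inj₁ g | _      = g
  ... | inj₂ _ | inj₁ g = g
  -- The two lists have at most 6 + 6 = 12 entries, and F has at least 13 vertices.
  ... | inj₂ (M , M<7 , x∈M , clM) | inj₂ starx with fresh (L ++ M)
          (subst (_< 10 + d) (sym (length-++ L))
            (≤-trans (s≤s (+-mono-≤ (s≤s⁻¹ L<7) (s≤s⁻¹ M<7))) (+-monoʳ-≤ 10 3≤d)))
  ... | y , y∉ with star y
  ... | inj₁ g = g
  ... | inj₂ stary = assemble clL v∈L clM x∉L x∈M (y∉ ∘ ∈-++⁺ˡ) (y∉ ∘ ∈-++⁺ʳ L) starx stary

-- From occurrences of patterns to subgraphs

module _ {N n : ℕ} (F : Graph N) (G : Graph n) (es : List (ℕ × ℕ))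
         (G≡es : ∀ i j → adj G i j ≡ hasEdge es i j) where
  open Soundness F

  holds-edge : ∀ {b f} fs → All (Holds n f) (map (λ (x , y) → pred x , pred y , b) fs) →
               ∀ i j → T (hasEdge fs i j) → adj F (f (toℕ {n} i)) (f (toℕ {n} j)) ≡ b
  holds-edge ((x , y) ∷ fs) (h ∷ hs) i j p with ∨⁻ {(lbl i ≡ᵇ x) ∧ (lbl j ≡ᵇ y)} p
  ... | inj₁ q with q₁ , q₂ ← ∧⁻ {lbl i ≡ᵇ x} q
               -- Once x is `lbl i`, a successor, `pred x` reduces to `toℕ i`, and the fact h speaks
               -- of the images of i and j.
               with refl ← ≡ᵇ⇒≡ (lbl i) x q₁ | refl ← ≡ᵇ⇒≡ (lbl j) y q₂ = proj₂ (proj₂ h)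
  ... | inj₂ r with ∨⁻ {(lbl i ≡ᵇ y) ∧ (lbl j ≡ᵇ x)} r
  ...   | inj₁ q with q₁ , q₂ ← ∧⁻ {lbl i ≡ᵇ y} q
                 with refl ← ≡ᵇ⇒≡ (lbl i) y q₁ | refl ← ≡ᵇ⇒≡ (lbl j) x q₂ =
                 trans (Graph.sym F _ _) (proj₂ (proj₂ h))
  ...   | inj₂ q = holds-edge fs hs i j q

  occurs⇒edges : ∀ {b} → ((f , _) : Occurs (prescribe b n es)) → ∀ i j → Edge G i j →
                  adj F (f (toℕ i)) (f (toℕ j)) ≡ b
  occurs⇒edges (f , _ , holds) i j e = holds-edge es holds i j (subst T (trans (sym e) (G≡es i j)) _)

  toℕ-inj : ∀ {f : ℕ → Fin N} → InjectiveBelow n f → Injective _≡_ _≡_ (f ∘ toℕ {n})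
  toℕ-inj inj {i} {j} eq = toℕ-injective (inj (toℕ<n i) (toℕ<n j) eq)

  occurs⇒⊆ : Occurs (prescribe true n es) → G ⊆ᴳ F
  occurs⇒⊆ o@(f , inj , _) = f ∘ toℕ , toℕ-inj inj , occurs⇒edges o

  complement-edge : ∀ {x y} → x ≢ y → adj F x y ≡ false → Edge (complement F) x y
  complement-edge {x} {y} x≢y e with x ≟ y
  ... | yes x≡y = contradiction x≡y x≢y
  ... | no  _   = cong not e

  -- Non-adjacency in F gives an edge of the complement only between distinct vertices; the ends of
  -- an edge of G are distinct and the assignment is injective.
  occurs⇒⊆-complement : Occurs (prescribe false n es) → G ⊆ᴳ complement F
  occurs⇒⊆-complement o@(f , inj , _) = f ∘ toℕ , toℕ-inj inj , λ i j e →
    complement-edge (λ eq → irreflexive e (toℕ-inj inj eq)) (occurs⇒edges o i j e)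
    where
    irreflexive : ∀ {i j} → Edge G i j → i ≢ j
    irreflexive {i} e refl with () ← trans (sym e) (irrefl G i)

upper : ∀ {d} (G : Graph 7) (es : List (ℕ × ℕ)) → (∀ i j → adj G i j ≡ hasEdge es i j) →
        Certified es d → 3 ≤ d → Arrows (10 + d) G wheel8
upper G es G≡es cert 3≤d F with Upper.goal cert 3≤d F
... | inj₁ o = inj₁ (occurs⇒⊆ F G es G≡es o)
... | inj₂ o = inj₂ (occurs⇒⊆-complement F wheel8 wheelEdges (λ _ _ → refl) o)

-- Lower bounds: excluding copies by colour classes

lookup-injective : ∀ {A : Set} {xs : List A} → Unique xs → ∀ i j → lookup xs i ≡ lookup xs j → i ≡ j
lookup-injective (_ ∷ u)   zero    zero    _  = refl
lookup-injective (x≢ ∷ u)  zero    (suc j) eq = contradiction eq (All.lookup x≢ (∈-lookup j))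
lookup-injective (x≢ ∷ u)  (suc i) zero    eq = contradiction (sym eq) (All.lookup x≢ (∈-lookup i))
lookup-injective (_ ∷ u)   (suc i) (suc j) eq = cong suc (lookup-injective u i j eq)

unique-length-≤ : ∀ {A : Set} {xs ys : List A} → Unique xs → xs ⊆ ys → length xs ≤ length ys
unique-length-≤ {xs = xs} {ys} u sub = injective⇒≤ {f = position} position-injective
  where
  position : Fin (length xs) → Fin (length ys)
  position i = index (sub (∈-lookup {xs = xs} i))
  position-injective : ∀ {i j} → position i ≡ position j → i ≡ j
  position-injective {i} {j} eq = lookup-injective u i j
    (index-injective (setoid _) (sub (∈-lookup i)) (sub (∈-lookup j)) eq)

-- A map from G to N vertices coloured by κ is excluded by listing the possible colours of the
-- vertices of G: R tells which colours may be adjacent, and no colour is used too often.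
module _ {n t N : ℕ} (G : Graph n) (R : Fin t → Fin t → Bool) (κ : Fin N → Fin t) where

  class : Fin t → List (Fin N)
  class c = filter (λ x → κ x ≟ c) (allFin N)

  Colouring : Set
  Colouring = List (Fin n × Fin t)

  coloured : Fin t → Colouring → Colouring
  coloured c = filter (λ p → proj₂ p ≟ c)

  fits : Colouring → Fin n → Fin t → Bool
  fits ps v c = (length (coloured c ps) <ᵇ length (class c)) ∧
                all (λ (u , b) → not (adj G u v) ∨ R b c) ps

  -- Exhaustive backtracking: every colour of v is either impossible or leads to a blocked
  -- colouring. With no vertex left a full colouring has been reached, hence `false`. Vertices of
  -- one class are interchangeable, so the search runs over colours and not over the N possible
  -- images.
  blocked : List (Fin n) → Colouring → Bool
  blocked []       ps = false
  blocked (v ∷ vs) ps = all (λ p → not (toℕ v ≡ᵇ toℕ (proj₁ p))) ps ∧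
                        all (λ c → not (fits ps v c) ∨ blocked vs ((v , c) ∷ ps)) (allFin t)

  module _ (f : Fin n → Fin N) (f-inj : Injective _≡_ _≡_ f)
           (f-hom : ∀ u v → Edge G u v → R (κ (f u)) (κ (f v)) ≡ true) where

    Faithful : Colouring → Set
    Faithful ps = All (λ (u , c) → κ (f u) ≡ c) ps × AllPairs (λ p q → proj₁ p ≢ proj₁ q) ps

    -- By injectivity of f, the distinct vertices of G with colour c have distinct images, all of
    -- them in the class of c.
    coloured-≤ : ∀ c {ps} → Faithful ps → length (coloured c ps) ≤ length (class c)
    coloured-≤ c {ps} (col , dist) = ≤-trans (≤-reflexive (sym (length-map (f ∘ proj₁) (coloured c ps))))
      (unique-length-≤
        (AllPairsₚ.map⁺ (AllPairs.map (λ p≢q eq → p≢q (f-inj eq))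
          (AllPairsₚ.filter⁺ (λ p → proj₂ p ≟ c) dist)))
        in-class)
      where
      in-class : map (f ∘ proj₁) (coloured c ps) ⊆ class c
      in-class x∈ with p , p∈ , refl ← ∈-map⁻ (f ∘ proj₁) x∈
                  with p∈ps , refl ← ∈-filter⁻ (λ q → proj₂ q ≟ c) {xs = ps} p∈ =
        ∈-filter⁺ (λ x → κ x ≟ c) (∈-allFin _) (All.lookup col p∈ps)

    extend-faithful : ∀ {ps} v → Faithful ps → T (all (λ p → not (toℕ v ≡ᵇ toℕ (proj₁ p))) ps) →
                      Faithful ((v , κ (f v)) ∷ ps)
    extend-faithful v (col , dist) new =
      refl ∷ col , All.map (λ q eq → not-≡ᵇ q (cong toℕ eq)) (Allₚ.all⁺ _ _ new) ∷ dist

    fits-complete : ∀ {ps} v → Faithful ((v , κ (f v)) ∷ ps) → T (fits ps v (κ (f v)))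
    fits-complete {ps} v faith@(_ ∷ col , _) = ∧⁺ (<⇒<ᵇ room) (Allₚ.all⁻ _ (All.map compatible col))
      where
      ∧⁺ : ∀ {x y} → T x → T y → T (x ∧ y)
      ∧⁺ {true} _ q = q
      room : length (coloured (κ (f v)) ps) < length (class (κ (f v)))
      -- The bound is applied after v has been added. As v has the colour in question, it accounts
      -- for one vertex, and the inequality for `ps` is strict.
      room with coloured-≤ (κ (f v)) faith
      ... | le with κ (f v) ≟ κ (f v)
      ...   | yes _ = le
      ...   | no ≢  = contradiction refl ≢
      compatible : ∀ {p} → κ (f (proj₁ p)) ≡ proj₂ p → T (not (adj G (proj₁ p) v) ∨ R (proj₂ p) (κ (f v)))
      compatible {u , _} refl with adj G u v in eq
      ... | true  = subst T (sym (f-hom u v eq)) _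
      ... | false = _

    -- Following at each vertex v the branch of its true colour κ (f v), the search never fails and
    -- arrives at the empty list, which is not blocked.
    blocked-sound : ∀ vs {ps} → Faithful ps → ¬ T (blocked vs ps)
    blocked-sound (v ∷ vs) {ps} faith b
      with b₁ , b₂ ← ∧⁻ {all (λ p → not (toℕ v ≡ᵇ toℕ (proj₁ p))) ps} b
      with faith′ ← extend-faithful v faith b₁
      with ∨⁻ {not (fits ps v (κ (f v)))} (All.lookup (Allₚ.all⁺ _ (allFin t) b₂) (∈-allFin (κ (f v))))
    ... | inj₁ q = not-T (fits-complete v faith′) q
      where
      not-T : ∀ {x} → T x → ¬ T (not x)
      not-T {true} _ ()
    ... | inj₂ q = blocked-sound vs faith′ q

module _ {t : ℕ} (es : List (ℕ × ℕ)) where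

  -- es lists the pairs of colours (numbered from 1) that are completely joined; a pair (c , c)
  -- makes a colour class a clique.
  blowUp : ∀ {N} → (Fin N → Fin t) → Graph N
  blowUp κ = record
    { adj    = λ x y → not (does (x ≟ y)) ∧ hasEdge es (κ x) (κ y)
    ; sym    = λ x y → cong₂ _∧_ (cong not (does-sym x y)) (hasEdge-sym es (κ x) (κ y))
    ; irrefl = irr
    }
    where
    does-sym : ∀ {N} (x y : Fin N) → does (x ≟ y) ≡ does (y ≟ x)
    does-sym x y with x ≟ y | y ≟ x
    ... | yes _ | yes _  = refl
    ... | no _  | no _   = refl
    ... | yes p | no ¬p  = contradiction (sym p) ¬p
    ... | no ¬p | yes p  = contradiction (sym p) ¬p
    irr : ∀ x → not (does (x ≟ x)) ∧ hasEdge es (κ x) (κ x) ≡ false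
    irr x with x ≟ x
    ... | yes _ = refl
    ... | no ≢  = contradiction refl ≢

  blowUp-edge : ∀ {N} (κ : Fin N → Fin t) x y → Edge (blowUp κ) x y → hasEdge es (κ x) (κ y) ≡ true
  blowUp-edge κ x y e with x ≟ y | e
  ... | no _ | e′ = e′

  blowUp-nonedge : ∀ {N} (κ : Fin N → Fin t) x y → Edge (complement (blowUp κ)) x y →
                   not (hasEdge es (κ x) (κ y)) ≡ true
  blowUp-nonedge κ x y e with x ≟ y | e
  ... | no ≢ | e′ with x ≟ y
  ...   | no _  = e′
  ...   | yes p = contradiction p ≢

  -- For M ≤ N the counterexample is the subgraph induced on the first M vertices. A copy found
  -- there, composed with the inclusion σ, is a map into all N vertices, so one search for each of G
  -- and H settles every M.
  lower : ∀ {n N} (G : Graph n) (H : Graph 9) (κ : Fin N → Fin t) →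
          T (blocked G (hasEdge es) κ (allFin n) []) →
          T (blocked H (λ c c′ → not (hasEdge es c c′)) κ (allFin 9) []) →
          ∀ M → M < suc N → ¬ Arrows M G H
  lower {N = N} G H κ noG noH M M≤N arrows = refute (arrows (blowUp (κ ∘ σ)))
    where
    σ : Fin M → Fin N
    σ x = inject≤ x (s≤s⁻¹ M≤N)
    σ-injective : ∀ {x y} → σ x ≡ σ y → x ≡ y
    σ-injective = inject≤-injective _ _ _ _
    refute : ¬ ((G ⊆ᴳ blowUp (κ ∘ σ)) ⊎ (H ⊆ᴳ complement (blowUp (κ ∘ σ))))
    refute (inj₁ (f , inj , hom)) =
      blocked-sound G (hasEdge es) κ (σ ∘ f) (inj ∘ σ-injective)
        (λ u v e → blowUp-edge (κ ∘ σ) (f u) (f v) (hom u v e)) (allFin _) ([] , []) noG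
    refute (inj₂ (f , inj , hom)) =
      blocked-sound H (λ c c′ → not (hasEdge es c c′)) κ (σ ∘ f) (inj ∘ σ-injective)
        (λ u v e → blowUp-nonedge (κ ∘ σ) (f u) (f v) (hom u v e)) (allFin 9) ([] , []) noH

-- In 2K₆ no component has seven vertices, and the complement K₆,₆ has no triangle whereas W₈ has.
κ₁₂ : Fin 12 → Fin 2
κ₁₂ = Vec.lookup (replicate 6 zero Vec.++ replicate 6 (suc zero))

-- K₆, two triangles, and the vertex completing both to K₄. A copy of D would span the two K₄, but
-- no vertex of D separates the other six into three and three. In the complement a hub from K₆ has
-- only seven neighbours; any other hub has six independent neighbours and at most three more, too
-- few for a C₈.
κ₁₃ : Fin 13 → Fin 4
κ₁₃ = Vec.lookup (replicate 6 zero Vec.++ replicate 3 (suc zero) Vec.++ replicate 3 (suc (suc zero)) Vec.++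
                  replicate 1 (suc (suc (suc zero))))

-- E has bipartition classes of sizes 2 and 5, so it is not in K₄,₄. In the complement the
-- neighbours of a hub from K₆ form two disjoint K₄; any other hub has six independent neighbours
-- and three more, too few for a C₈.
κ₁₄ : Fin 14 → Fin 3
κ₁₄ = Vec.lookup (replicate 6 zero Vec.++ replicate 4 (suc zero) Vec.++ replicate 4 (suc (suc zero)))

2K₆-excludes : ∀ {n} (G : Graph n) →
  T (blocked G (hasEdge ((1 , 1) ∷ (2 , 2) ∷ [])) κ₁₂ (allFin n) []) →
  ∀ M → M < 13 → ¬ Arrows M G wheel8
2K₆-excludes G noG = lower ((1 , 1) ∷ (2 , 2) ∷ []) G wheel8 κ₁₂ noG _

-- The certificates were found by computer search.

-- Three neighbours of vertex 0 give a star, and three exits enlarge it to a tree on seven vertices;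
-- its vertex of degree at least 3 is why the path never arises. All targets are shapes, so one
-- certificate serves all five trees.
exhaustion : Certificate
exhaustion =
  grow 0 (grow 0 (grow 0 (exit (exit (exit (embed 1 0x6543210 ∷ embed 2 0x6543210 ∷
  embed 2 0x6543120 ∷ embed 2 0x6542130 ∷ embed 2 0x6532140 ∷ embed 2 0x6432150 ∷ []) ∷ exit
  (embed 2 0x5643210 ∷ embed 3 0x6543210 ∷ embed 4 0x6543210 ∷ embed 4 0x6542310 ∷ embed 4 0x6532410
  ∷ embed 5 0x6543210 ∷ []) ∷ exit (embed 2 0x5643120 ∷ embed 4 0x5643210 ∷ embed 3 0x6543120 ∷
  embed 4 0x6541320 ∷ embed 4 0x6531420 ∷ embed 5 0x6543120 ∷ []) ∷ exit (embed 2 0x5642130 ∷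
  embed 4 0x5642310 ∷ embed 4 0x5641320 ∷ embed 3 0x6542130 ∷ embed 4 0x6521430 ∷ embed 5 0x6542130
  ∷ []) ∷ exit (embed 2 0x5632140 ∷ embed 4 0x5632410 ∷ embed 4 0x5631420 ∷ embed 4 0x5621430 ∷
  embed 3 0x6532140 ∷ embed 5 0x6532140 ∷ []) ∷ []) ∷ exit (exit (embed 2 0x4653210 ∷
  embed 3 0x6453210 ∷ embed 4 0x6453210 ∷ embed 4 0x6452310 ∷ embed 5 0x6453210 ∷ embed 4 0x6432510
  ∷ []) ∷ exit (embed 3 0x5463210 ∷ embed 3 0x3265401 ∷ embed 6 0x6543210 ∷ embed 6 0x6542310 ∷
  embed 6 0x6325401 ∷ embed 6 0x6324501 ∷ []) ∷ exit (embed 4 0x5463210 ∷ embed 6 0x5643210 ∷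
  embed 6 0x4653120 ∷ embed 7 0x6543210 ∷ embed 8 0x6543210 ∷ embed 8 0x6453120 ∷ []) ∷ exit
  (embed 4 0x5462310 ∷ embed 6 0x5642310 ∷ embed 7 0x5643210 ∷ embed 6 0x4652130 ∷ embed 8 0x6542310
  ∷ embed 8 0x6452130 ∷ []) ∷ exit (embed 5 0x5463210 ∷ embed 6 0x5326401 ∷ embed 8 0x5643210 ∷
  embed 8 0x5642310 ∷ embed 9 0x6543210 ∷ embed 10 0x6543210 ∷ []) ∷ []) ∷ exit (exit
  (embed 2 0x4653120 ∷ embed 4 0x4653210 ∷ embed 3 0x6453120 ∷ embed 4 0x6451320 ∷ embed 5 0x6453120
  ∷ embed 4 0x6431520 ∷ []) ∷ exit (embed 4 0x4563210 ∷ embed 6 0x4653210 ∷ embed 6 0x5643120 ∷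
  embed 7 0x6453210 ∷ embed 8 0x6543120 ∷ embed 8 0x6453210 ∷ []) ∷ exit (embed 3 0x5463120 ∷
  embed 6 0x6543120 ∷ embed 3 0x3165402 ∷ embed 6 0x6541320 ∷ embed 6 0x6315402 ∷ embed 6 0x6314502
  ∷ []) ∷ exit (embed 4 0x5461320 ∷ embed 7 0x5463210 ∷ embed 6 0x5641320 ∷ embed 6 0x4651230 ∷
  embed 8 0x6541320 ∷ embed 8 0x6451230 ∷ []) ∷ exit (embed 5 0x5463120 ∷ embed 8 0x5643120 ∷
  embed 6 0x5316402 ∷ embed 8 0x5641320 ∷ embed 9 0x6543120 ∷ embed 10 0x6543120 ∷ []) ∷ []) ∷ exit
  (exit (embed 2 0x4652130 ∷ embed 4 0x4652310 ∷ embed 4 0x4651320 ∷ embed 3 0x6452130 ∷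
  embed 5 0x6452130 ∷ embed 4 0x6421530 ∷ []) ∷ exit (embed 4 0x4562310 ∷ embed 6 0x4652310 ∷
  embed 7 0x4653210 ∷ embed 6 0x5642130 ∷ embed 8 0x6542130 ∷ embed 8 0x6452310 ∷ []) ∷ exit
  (embed 4 0x4561320 ∷ embed 7 0x4563210 ∷ embed 6 0x4651320 ∷ embed 6 0x5641230 ∷ embed 8 0x6541230
  ∷ embed 8 0x6451320 ∷ []) ∷ exit (embed 3 0x5462130 ∷ embed 6 0x6542130 ∷ embed 6 0x6541230 ∷
  embed 3 0x2165403 ∷ embed 6 0x6215403 ∷ embed 6 0x6214503 ∷ []) ∷ exit (embed 5 0x5462130 ∷
  embed 8 0x5642130 ∷ embed 8 0x5641230 ∷ embed 6 0x5216403 ∷ embed 9 0x6542130 ∷ embed 10 0x6542130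
  ∷ []) ∷ []) ∷ []))))

-- Tree A: the spider with legs of lengths 1, 1, 4

edgesA : List (ℕ × ℕ)
edgesA = (1 , 2) ∷ (2 , 3) ∷ (3 , 4) ∷ (4 , 5) ∷ (5 , 6) ∷ (2 , 7) ∷ []

-- In `sparseA`, as for the other trees, entry 8 closes a path on eight vertices of the complement
-- into a C₈ among the ten, and entries 7 down to 1 each prolong a path by one vertex, unless the
-- tree appears.
sparseA denseA : List (ℕ × Certificate)
sparseA =
  -- The rim 0, 4, 1, 5, 2, 6, 3, 7 alternates between the two sides; the hub is 8.
  (10 , embed 9 0x873625140) ∷
  (8 , split 7 0 (split 9 7 (split 9 0 (split 8 7 (split 8 0 (split 7 5 (split 7 4 (split 9 6
      (embed 0 0x5690874) (split 9 1 (embed 0 0x5190874) (split 8 3 (embed 0 0x5380974) (split 8 2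
      (embed 0 0x5280974) (embed 9 0xa96543821))))) (split 5 0 (split 6 0 (split 8 4
      (embed 0 0x9487506) (split 8 1 (embed 0 0x9187506) (split 5 3 (embed 0 0x9357806)
      (embed 9 0xa84765321)))) (split 7 3 (split 5 3 (split 5 2 (embed 0 0x9253708) (split 3 1
      (embed 0 0x9137508) (embed 9 0xa67452310))) (embed 9 0xa67453210)) (embed 9 0xa65473210)))
      (embed 9 0xa56743210))) (split 6 0 (split 5 0 (split 9 3 (embed 0 0x6397805) (split 9 1
      (embed 0 0x6197805) (split 8 4 (embed 0 0x6487905) (split 8 3 (embed 0 0x6387905) (split 7 2
      (split 7 1 (split 6 1 (embed 0 0x8271605) (embed 9 0xa67548321)) (embed 9 0xa76548321))
      (embed 9 0xa93845721)))))) (split 7 4 (split 6 4 (split 6 3 (embed 0 0x9364708) (split 4 2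
      (embed 0 0x9247806) (embed 9 0xa57634210))) (embed 9 0xa57643210)) (embed 9 0xa56743210)))
      (embed 9 0xa67543210))) (split 8 6 (split 6 1 (split 9 5 (embed 0 0x5168790) (split 9 4
      (embed 0 0x4168790) (split 6 4 (embed 0 0x4907861) (split 6 3 (embed 0 0x3907861) (split 5 0
      (embed 0 0x9168705) (embed 9 0xa59463210)))))) (split 8 2 (split 9 5 (embed 0 0x6590782)
      (split 9 4 (embed 0 0x6490782) (split 4 0 (embed 0 0x6409782) (split 3 0 (embed 0 0x6309782)
      (embed 9 0xa49561230))))) (embed 9 0xa82345610))) (embed 9 0xa86543210))) (split 8 1
      (split 8 0 (split 6 1 (split 9 5 (embed 0 0x7618095) (split 9 4 (embed 0 0x7618094) (split 7 4
      (embed 0 0x9618074) (split 6 3 (embed 0 0x9361807) (split 5 1 (embed 0 0x6970815)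
      (embed 9 0xa59476321)))))) (split 8 5 (split 9 4 (embed 0 0x5497081) (split 9 3
      (embed 0 0x5397081) (split 7 3 (embed 0 0x5379081) (split 7 2 (embed 0 0x5279081)
      (embed 9 0xa65493721))))) (embed 9 0xa67854321))) (split 8 6 (split 6 4 (split 4 2 (split 2 0
      (embed 0 0x9864207) (embed 9 0xa87654320)) (embed 9 0xa87654210)) (embed 9 0xa87643210))
      (embed 9 0xa86543210))) (embed 9 0xa87654321))) (split 9 6 (split 9 5 (split 8 0 (split 8 4
      (embed 0 0x6480795) (split 8 3 (embed 0 0x6380795) (split 8 1 (embed 0 0x6180795) (split 7 2
      (split 7 1 (split 6 0 (embed 0 0x2596071) (embed 9 0xa65483210)) (embed 9 0xa76548321))
      (embed 9 0xa83456721))))) (split 8 6 (split 8 7 (split 9 4 (embed 0 0x5078694) (split 7 2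
      (embed 0 0x2596870) (embed 9 0xa94567210))) (split 9 3 (split 8 1 (split 6 4 (split 5 3
      (split 3 1 (embed 0 0x9468135) (embed 9 0xa87654310)) (embed 9 0xa87653210))
      (embed 9 0xa87643210)) (embed 9 0xa87654321)) (embed 9 0xa93456780))) (embed 9 0xa86543210)))
      (split 7 3 (split 6 4 (split 8 4 (embed 0 0x3846970) (split 4 2 (embed 0 0x3246970) (split 4 1
      (embed 0 0x3146970) (split 8 3 (split 7 2 (split 6 2 (embed 0 0x9837264)
      (embed 9 0xa95623410)) (embed 9 0xa95672410)) (embed 9 0xa95483210))))) (embed 9 0xa95643210))
      (embed 9 0xa95673210))) (embed 9 0xa96543210))) (split 9 1 (split 9 0 (split 9 4 (split 8 7
      (split 8 6 (embed 0 0x4687091) (split 8 5 (embed 0 0x4587091) (split 8 3 (embed 0 0x4387091)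
      (split 8 2 (embed 0 0x4287091) (split 7 1 (split 6 0 (split 4 0 (split 3 0 (embed 0 0x6719403)
      (embed 9 0xa34568210)) (embed 9 0xa45683210)) (embed 9 0xa68543210))
      (embed 9 0xa76854321)))))) (split 8 1 (split 8 0 (split 9 6 (embed 0 0x6708194) (split 9 5
      (embed 0 0x5708194) (split 6 0 (embed 0 0x7491806) (embed 9 0xa69543210)))) (split 8 6
      (split 6 4 (split 4 2 (split 2 0 (embed 0 0x9864207) (embed 9 0xa87654320))
      (embed 9 0xa87654210)) (embed 9 0xa87643210)) (embed 9 0xa86543210))) (embed 9 0xa87654321)))
      (split 6 0 (split 5 1 (split 8 5 (embed 0 0x7851906) (split 5 3 (embed 0 0x7351906) (split 5 2
      (embed 0 0x7251906) (split 8 6 (split 6 1 (split 4 1 (split 4 0 (embed 0 0x9861407)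
      (embed 9 0xa49765210)) (embed 9 0xa49765321)) (embed 9 0xa67945321)) (embed 9 0xa58679432)))))
      (embed 9 0xa56794321)) (embed 9 0xa67943210))) (split 9 6 (split 6 4 (split 4 2 (split 2 0
      (split 8 6 (embed 0 0x9702468) (split 8 0 (embed 0 0x8964207) (embed 9 0xa86543210)))
      (embed 9 0xa97654320)) (embed 9 0xa97654210)) (embed 9 0xa97643210)) (embed 9 0xa96543210)))
      (embed 9 0xa97654321))) (embed 9 0xa76543210)) ∷
  (7 , split 9 6 (split 9 0 (split 8 6 (split 8 0 (split 7 6 (split 7 0 (split 9 5 (split 9 4
      (embed 0 0x5867094) (split 6 2 (embed 0 0x8590762) (split 3 0 (embed 0 0x8596703)
      (embed 8 0xa8794562103)))) (split 9 7 (split 9 4 (split 6 4 (split 6 0 (split 7 3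
      (embed 0 0x8379064) (split 6 3 (embed 0 0x8364907) (split 6 2 (embed 0 0x8264907) (split 5 0
      (embed 0 0x8794605) (split 4 2 (embed 0 0x8249607) (split 4 1 (embed 0 0x8149607)
      (embed 8 0xa9873624105))))))) (embed 8 0xa8795432106)) (embed 8 0xa8795643210))
      (embed 8 0xa8765943210)) (embed 8 0xa8679543210))) (embed 8 0xa9865432107))
      (embed 8 0xa9876543210)) (embed 8 0xa9765432108)) (embed 8 0xa9786543210))
      (embed 8 0xa8765432109)) (embed 8 0xa8796543210)) ∷
  (6 , split 9 0 (split 8 0 (split 7 5 (split 7 0 (split 6 5 (split 6 4 (embed 0 0x9465708)
      (split 6 3 (embed 0 0x9365708) (embed 7 0xa9875463210))) (embed 7 0xa9876543210))
      (embed 7 0xa9865432107)) (embed 7 0xa9867543210)) (embed 7 0xa9765432108))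
      (embed 7 0xa8765432109)) ∷
  (5 , split 9 0 (split 8 4 (split 8 0 (split 7 0 (split 6 4 (split 6 0 (split 5 4 (split 5 0
      (split 6 5 (embed 0 0x9846507) (split 5 3 (embed 0 0x8354607) (embed 6 0xa9874653210)))
      (embed 6 0xa9876432105)) (embed 6 0xa9876543210)) (embed 6 0xa9875432106))
      (embed 6 0xa9875643210)) (embed 6 0xa9865432107)) (embed 6 0xa9765432108))
      (embed 6 0xa9765843210)) (embed 6 0xa8765432109)) ∷
  (4 , split 8 0 (split 7 3 (split 7 0 (split 6 0 (split 5 3 (split 5 0 (split 4 3 (split 4 0
      (split 5 4 (embed 0 0x8735406) (split 4 2 (embed 0 0x7243506) (embed 5 0xa9876354210)))
      (embed 5 0xa9876532104)) (embed 5 0xa9876543210)) (embed 5 0xa9876432105))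
      (embed 5 0xa9876453210)) (embed 5 0xa9875432106)) (embed 5 0xa9865432107))
      (embed 5 0xa9865473210)) (embed 5 0xa9765432108)) ∷
  (3 , split 7 0 (split 6 2 (split 6 0 (split 5 0 (split 4 2 (split 4 0 (split 3 2 (split 3 0
      (split 4 3 (embed 0 0x7624305) (split 3 1 (embed 0 0x6132405) (embed 4 0xa9876524310)))
      (embed 4 0xa9876542103)) (embed 4 0xa9876543210)) (embed 4 0xa9876532104))
      (embed 4 0xa9876534210)) (embed 4 0xa9876432105)) (embed 4 0xa9875432106))
      (embed 4 0xa9875436210)) (embed 4 0xa9865432107)) ∷
  (2 , split 6 0 (split 5 1 (split 4 1 (split 4 0 (split 3 1 (split 3 0 (split 2 0 (split 4 2
      (embed 0 0x6514203) (split 3 2 (embed 0 0x6513204) (embed 3 0xa9876510423)))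
      (embed 3 0xa9876543201)) (embed 3 0xa9876542301)) (embed 3 0xa9876542310))
      (embed 3 0xa9876532401)) (embed 3 0xa9876532410)) (embed 3 0xa9876432510))
      (embed 3 0xa9875432601)) ∷
  (1 , split 6 0 (split 5 3 (split 4 0 (split 3 2 (split 2 1 (split 1 0 (embed 0 0x6532104)
      (embed 2 0xa9876543210)) (embed 2 0xa9876543021)) (embed 2 0xa9876541032))
      (embed 2 0xa9876532140)) (embed 2 0xa9876421053)) (embed 2 0xa9875432160)) ∷ []
-- The first entry, for each of the five trees, identifies the tree itself among the shapes; the
-- later ones lead to it directly or through shapes already resolved.
denseA =
  (10 , embed 0 0x3654102) ∷
  (9 , split 6 2 (embed 0 0x3546201) (split 6 1 (embed 0 0x3546102) (split 5 2 (embed 0 0x3645201)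
      (split 5 1 (embed 0 0x3645102) (split 3 2 (embed 0 0x6320145) (split 3 1 (embed 0 0x6203145)
      (split 2 1 (embed 0 0x6302145) (split 2 4 (grow 1 (embed 0 0x6710245)) (grow 2
      (embed 0 0x6720145)))))))))) ∷
  (3 , split 6 2 (embed 0 0x4516203) (split 5 2 (embed 0 0x4615203) (split 2 1 (embed 9 0x6514320)
      (split 2 3 (split 4 2 (embed 0 0x6423015) (grow 2 (embed 0 0x6723015))) (split 2 4 (grow 2
      (embed 0 0x6724015)) (grow 2 (grow 2 (embed 9 0x8726501)))))))) ∷
  (2 , split 5 1 (embed 3 0x6543210) (split 4 1 (embed 3 0x6453210) (split 3 1 (embed 3 0x6354210)
      (split 2 1 (embed 3 0x6254310) (grow 1 (embed 3 0x7643210)))))) ∷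
  (5 , split 6 1 (embed 3 0x6543210) (split 4 1 (embed 0 0x3651402) (split 3 1 (embed 0 0x4651302)
      (split 2 1 (embed 0 0x4651203) (grow 1 (embed 3 0x7543210)))))) ∷
  (1 , split 6 1 (embed 2 0x6543210) (split 5 1 (embed 2 0x5643210) (split 4 1 (embed 2 0x4653210)
      (split 3 1 (embed 2 0x3654210) (split 2 1 (embed 2 0x2654310) (grow 1
      (embed 2 0x7543210))))))) ∷
  (4 , split 6 5 (embed 0 0x4265103) (split 5 2 (embed 0 0x4625103) (split 5 0 (embed 2 0x6543120)
      (split 5 3 (split 5 4 (embed 0 0x4620153) (grow 5 (embed 0 0x7620153))) (split 5 4 (grow 5
      (embed 0 0x7620154)) (grow 5 (embed 5 0x7543210))))))) ∷
  (6 , split 6 3 (embed 0 0x5362014) (split 6 1 (embed 0 0x5302614) (split 6 0 (embed 3 0x5463210)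
      (split 6 4 (split 6 5 (embed 0 0x3564102) (grow 6 (embed 0 0x3764102))) (split 6 5 (grow 6
      (embed 0 0x3765102)) (grow 6 (embed 0 0x5762014))))))) ∷
  (8 , split 5 4 (embed 0 0x3645201) (split 4 3 (embed 0 0x6520143) (split 4 2 (embed 6 0x6315402)
      (split 4 0 (embed 4 0x6531420) (grow 4 (embed 0 0x7520146)))))) ∷
  (7 , split 6 1 (embed 6 0x5643210) (split 5 1 (embed 6 0x6542310) (split 3 1 (embed 8 0x5624301)
      (split 2 1 (embed 8 0x6534201) (grow 1 (embed 6 0x5743210)))))) ∷ []

certifiedA : Certified edgesA 3
certifiedA = record { sparse = sparseA ; dense = denseA ; exhaust = exhaustion }

-- Tree B: the spider with legs of lengths 1, 2, 3

edgesB : List (ℕ × ℕ)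
edgesB = (1 , 2) ∷ (2 , 3) ∷ (3 , 4) ∷ (4 , 5) ∷ (5 , 6) ∷ (3 , 7) ∷ []

sparseB denseB : List (ℕ × Certificate)
sparseB =
  (10 , embed 9 0x873625140) ∷
  (8 , split 7 0 (split 9 7 (split 9 0 (split 8 7 (split 8 0 (split 7 5 (split 4 0 (split 9 6
      (embed 0 0x4578096) (split 9 1 (embed 0 0x4578091) (split 8 6 (embed 0 0x4579086) (split 8 3
      (embed 0 0x4579083) (split 5 3 (embed 0 0x9408753) (split 4 2 (embed 0 0x9578042)
      (embed 9 0xa96835421))))))) (split 7 3 (split 6 3 (embed 0 0x5908736) (split 5 2
      (embed 0 0x3908752) (split 3 1 (embed 0 0x5908731) (split 7 4 (split 7 1 (split 6 4
      (embed 0 0x1908746) (split 5 3 (embed 0 0x1908735) (split 9 5 (split 8 6 (embed 0 0x1680759)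
      (split 8 4 (embed 0 0x1590748) (split 6 0 (embed 0 0x6178095) (embed 9 0xa68453210))))
      (split 9 2 (split 9 1 (embed 0 0x3291708) (embed 9 0xa46325910)) (embed 9 0xa46359210)))))
      (embed 9 0xa45236710)) (embed 9 0xa47652310))))) (embed 9 0xa45673210))) (split 6 0 (split 6 1
      (split 7 4 (embed 0 0x9478061) (split 5 0 (embed 0 0x5978061) (embed 9 0xa56743210)))
      (split 2 0 (split 6 4 (embed 0 0x2978064) (split 6 3 (embed 0 0x2978063) (split 4 2
      (embed 0 0x6978024) (split 4 0 (split 3 0 (split 5 3 (embed 0 0x2978035) (split 9 4 (split 8 6
      (embed 0 0x2786049) (split 8 1 (embed 0 0x2187049) (embed 9 0xa86754321))) (split 9 2
      (split 9 1 (embed 0 0x3192078) (embed 9 0xa94675321)) (embed 9 0xa67534921))))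
      (embed 9 0xa36754210)) (embed 9 0xa45763210))))) (embed 9 0xa23457610)))
      (embed 9 0xa67543210))) (split 8 6 (split 7 1 (split 9 5 (embed 0 0x1590786) (split 9 4
      (embed 0 0x1490786) (split 6 4 (embed 0 0x1468709) (split 6 3 (embed 0 0x1368709) (split 5 0
      (embed 0 0x1509786) (embed 9 0xa59463210)))))) (split 8 3 (split 2 0 (split 7 5
      (embed 0 0x5209783) (split 6 0 (embed 0 0x2386079) (embed 9 0xa67543210)))
      (embed 9 0xa23456710)) (embed 9 0xa83456710))) (embed 9 0xa86543210))) (split 8 1 (split 8 0
      (split 6 0 (split 9 5 (embed 0 0x6597081) (split 9 4 (embed 0 0x6497081) (split 7 3
      (embed 0 0x6379081) (split 4 1 (embed 0 0x6418079) (embed 9 0xa49567321))))) (split 8 4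
      (split 7 5 (split 7 4 (embed 0 0x5184709) (split 5 3 (embed 0 0x9357081)
      (embed 9 0xa67453210))) (embed 9 0xa67543210)) (embed 9 0xa67843210))) (split 7 5 (split 5 3
      (split 4 2 (split 2 0 (embed 0 0x9357024) (embed 9 0xa87654320)) (embed 9 0xa87654210))
      (embed 9 0xa87653210)) (embed 9 0xa87543210))) (embed 9 0xa87654321))) (split 9 6 (split 9 5
      (split 4 0 (split 8 6 (embed 0 0x5407968) (split 8 5 (embed 0 0x6407958) (split 6 3
      (embed 0 0x5407963) (split 6 2 (embed 0 0x5407962) (split 6 1 (embed 0 0x5407961) (split 5 1
      (embed 0 0x6407951) (split 9 2 (split 7 4 (split 7 1 (split 3 0 (split 2 0 (embed 0 0x3174029)
      (embed 9 0xa23458610)) (embed 9 0xa34586210)) (embed 9 0xa76854321)) (embed 9 0xa58674321))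
      (embed 9 0xa92634510)))))))) (split 7 3 (split 6 3 (split 8 6 (embed 0 0x8073695) (split 8 0
      (embed 0 0x5807963) (embed 9 0xa86543210))) (split 9 1 (split 7 5 (split 8 6
      (embed 0 0x1075968) (split 8 0 (embed 0 0x3195708) (embed 9 0xa86543210)))
      (embed 9 0xa45763210)) (embed 9 0xa91236540))) (embed 9 0xa45673210))) (split 7 3 (split 6 4
      (split 8 3 (embed 0 0x0469738) (split 8 0 (embed 0 0x3469708) (split 5 0 (embed 0 0x3469705)
      (split 2 0 (embed 0 0x3469702) (split 9 1 (split 8 2 (split 7 4 (split 6 2 (split 6 1
      (split 4 1 (embed 0 0x9826147) (embed 9 0xa95412380)) (embed 9 0xa83456120))
      (embed 9 0xa83456210)) (embed 9 0xa56743210)) (embed 9 0xa95438210))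
      (embed 9 0xa83459120)))))) (embed 9 0xa95643210)) (embed 9 0xa95673210)))
      (embed 9 0xa96543210))) (split 9 1 (split 9 0 (split 9 4 (split 8 1 (split 8 6
      (embed 0 0x4681907) (split 8 5 (embed 0 0x4581907) (split 8 3 (embed 0 0x4381907) (split 8 2
      (embed 0 0x4281907) (split 7 5 (embed 0 0x4570918) (split 7 3 (embed 0 0x4370918) (split 7 2
      (embed 0 0x4270918) (split 9 3 (split 6 0 (split 5 1 (split 4 1 (split 4 0 (split 3 0
      (embed 0 0x6514039) (embed 9 0xa38657210)) (embed 9 0xa45673210)) (embed 9 0xa45867321))
      (embed 9 0xa54386721)) (embed 9 0xa67543210)) (embed 9 0xa86543972))))))))) (split 8 7
      (split 6 4 (embed 0 0x1870946) (split 5 1 (embed 0 0x4870915) (split 4 2 (embed 0 0x1870942)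
      (split 3 1 (embed 0 0x4870913) (split 9 3 (split 9 2 (split 6 3 (embed 0 0x1870936) (split 6 2
      (embed 0 0x1870926) (split 5 3 (embed 0 0x1870935) (split 5 2 (embed 0 0x1870925) (split 8 5
      (split 7 4 (embed 0 0x4190785) (split 6 0 (embed 0 0x6587091) (embed 9 0xa67453210)))
      (split 7 3 (split 7 1 (split 4 0 (split 3 0 (split 2 0 (embed 0 0x4173029)
      (embed 9 0xa26435810)) (embed 9 0xa36425810)) (embed 9 0xa46325810)) (embed 9 0xa85432671))
      (embed 9 0xa85467321))))))) (embed 9 0xa34567921)) (embed 9 0xa54679321))))))
      (embed 9 0xa87654321))) (split 6 0 (split 5 1 (split 8 7 (embed 0 0x6519078) (split 8 6
      (embed 0 0x7519068) (split 7 3 (embed 0 0x6519073) (split 6 4 (embed 0 0x7519064) (split 6 3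
      (embed 0 0x7519063) (split 6 2 (embed 0 0x7519062) (split 6 1 (split 5 3 (split 4 1 (split 4 0
      (split 3 0 (embed 0 0x7614035) (embed 9 0xa37946210)) (embed 9 0xa49763210))
      (embed 9 0xa49786321)) (embed 9 0xa68794532)) (embed 9 0xa68794321))))))))
      (embed 9 0xa56794321)) (embed 9 0xa67943210))) (split 9 6 (split 7 5 (split 6 4 (split 5 3
      (split 4 2 (split 3 1 (split 2 0 (split 8 6 (embed 0 0x8319642) (split 8 0 (embed 0 0x8357024)
      (embed 9 0xa86543210))) (embed 9 0xa97654320)) (embed 9 0xa97654310)) (embed 9 0xa97654210))
      (embed 9 0xa97653210)) (embed 9 0xa97643210)) (embed 9 0xa97543210)) (embed 9 0xa96543210)))
      (embed 9 0xa97654321))) (embed 9 0xa76543210)) ∷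
  (7 , split 9 6 (split 9 0 (split 8 6 (split 8 0 (split 7 6 (split 7 0 (split 9 5 (split 7 3
      (embed 0 0x3596708) (split 6 3 (embed 0 0x8367095) (split 5 2 (embed 0 0x8259076) (split 4 0
      (embed 0 0x4867095) (embed 8 0xa9873652104))))) (split 9 8 (split 9 7 (split 9 4 (split 6 4
      (split 6 0 (split 7 3 (embed 0 0x8379064) (split 6 3 (embed 0 0x8497063) (split 6 2
      (embed 0 0x8497062) (split 5 0 (embed 0 0x5897064) (split 4 2 (embed 0 0x8249067) (split 4 1
      (embed 0 0x8149067) (embed 8 0xa9873624105))))))) (embed 8 0xa8795432106))
      (embed 8 0xa8795643210)) (embed 8 0xa8765943210)) (embed 8 0xa8679543210))
      (embed 8 0xa7689543210))) (embed 8 0xa9865432107)) (embed 8 0xa9876543210))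
      (embed 8 0xa9765432108)) (embed 8 0xa9786543210)) (embed 8 0xa8765432109))
      (embed 8 0xa8796543210)) ∷
  (6 , split 9 0 (split 8 5 (split 7 5 (split 7 0 (split 6 0 (split 6 4 (embed 0 0x9857064)
      (split 6 3 (embed 0 0x9857063) (embed 7 0xa9875463210))) (embed 7 0xa9875432106))
      (embed 7 0xa9865432107)) (embed 7 0xa9867543210)) (embed 7 0xa9768543210))
      (embed 7 0xa8765432109)) ∷
  (5 , split 9 0 (split 8 4 (split 8 0 (split 7 4 (split 7 0 (split 6 4 (split 6 0 (split 5 0
      (split 6 5 (embed 0 0x9847056) (split 5 3 (embed 0 0x8746053) (embed 6 0xa9874653210)))
      (embed 6 0xa9876432105)) (embed 6 0xa9875432106)) (embed 6 0xa9875643210))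
      (embed 6 0xa9865432107)) (embed 6 0xa9865743210)) (embed 6 0xa9765432108))
      (embed 6 0xa9765843210)) (embed 6 0xa8765432109)) ∷
  (4 , split 8 0 (split 7 3 (split 7 0 (split 6 3 (split 6 0 (split 5 3 (split 5 0 (split 4 0
      (split 5 4 (embed 0 0x8736045) (split 4 2 (embed 0 0x7635042) (embed 5 0xa9876354210)))
      (embed 5 0xa9876532104)) (embed 5 0xa9876432105)) (embed 5 0xa9876453210))
      (embed 5 0xa9875432106)) (embed 5 0xa9875463210)) (embed 5 0xa9865432107))
      (embed 5 0xa9865473210)) (embed 5 0xa9765432108)) ∷
  (3 , split 7 0 (split 6 2 (split 6 0 (split 5 2 (split 5 0 (split 4 2 (split 4 0 (split 3 0
      (split 4 3 (embed 0 0x7625034) (split 3 1 (embed 0 0x6524031) (embed 4 0xa9876524310)))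
      (embed 4 0xa9876542103)) (embed 4 0xa9876532104)) (embed 4 0xa9876534210))
      (embed 4 0xa9876432105)) (embed 4 0xa9876435210)) (embed 4 0xa9875432106))
      (embed 4 0xa9875436210)) (embed 4 0xa9865432107)) ∷
  (2 , split 6 0 (split 5 1 (split 4 1 (split 4 0 (split 3 1 (split 3 0 (split 2 0 (split 4 2
      (embed 0 0x6513024) (split 3 2 (embed 0 0x6514023) (embed 3 0xa9876510423)))
      (embed 3 0xa9876543201)) (embed 3 0xa9876542301)) (embed 3 0xa9876542310))
      (embed 3 0xa9876532401)) (embed 3 0xa9876532410)) (embed 3 0xa9876432510))
      (embed 3 0xa9875432601)) ∷
  (1 , split 6 0 (split 5 3 (split 4 1 (split 3 2 (split 2 0 (split 1 0 (embed 0 0x6532014)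
      (embed 2 0xa9876543210)) (embed 2 0xa9876543120)) (embed 2 0xa9876541032))
      (embed 2 0xa9876532041)) (embed 2 0xa9876421053)) (embed 2 0xa9875432160)) ∷ []
denseB =
  (8 , embed 0 0x3641025) ∷
  (6 , split 6 4 (embed 0 0x3462015) (split 5 4 (embed 0 0x3541026) (split 4 3 (embed 0 0x5620143)
      (split 4 2 (embed 0 0x5624103) (split 4 0 (embed 0 0x3514026) (grow 4
      (embed 0 0x3741026))))))) ∷
  (4 , split 6 1 (embed 6 0x2435601) (split 4 1 (embed 0 0x3514026) (split 3 1 (embed 0 0x4513026)
      (split 2 1 (embed 6 0x6435201) (grow 1 (embed 6 0x6753210)))))) ∷
  (7 , split 6 1 (embed 0 0x4520163) (split 5 1 (embed 0 0x4630152) (split 3 1 (embed 0 0x4520136)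
      (split 2 1 (embed 0 0x4630125) (grow 1 (embed 6 0x5743210)))))) ∷
  (9 , split 6 1 (embed 6 0x5326401) (split 5 1 (embed 6 0x6325401) (split 3 1 (embed 6 0x2653041)
      (split 2 1 (embed 6 0x3652041) (grow 1 (embed 6 0x5327401)))))) ∷
  (10 , split 6 1 (embed 6 0x5326401) (split 5 1 (embed 6 0x6324501) (split 3 1 (embed 0 0x3654102)
      (split 2 1 (embed 0 0x2654103) (grow 1 (embed 0 0x7654102)))))) ∷
  (3 , split 6 2 (embed 6 0x2435601) (split 5 2 (embed 6 0x2436501) (split 4 2 (embed 6 0x4653210)
      (split 3 2 (embed 6 0x3654210) (split 2 1 (embed 9 0x6514320) (grow 2
      (embed 6 0x7653210))))))) ∷
  (2 , split 5 1 (embed 3 0x6543210) (split 4 1 (embed 3 0x6453210) (split 3 1 (embed 3 0x6354210)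
      (split 2 1 (embed 3 0x6254310) (grow 1 (embed 3 0x7643210)))))) ∷
  (5 , split 6 1 (embed 3 0x6543210) (split 4 1 (embed 6 0x6324501) (split 3 1 (embed 6 0x6423501)
      (split 2 1 (embed 6 0x6432501) (grow 1 (embed 6 0x6327501)))))) ∷
  (1 , split 6 1 (embed 2 0x6543210) (split 5 1 (embed 2 0x5643210) (split 4 1 (embed 2 0x4653210)
      (split 3 1 (embed 2 0x3654210) (split 2 1 (embed 2 0x2654310) (grow 1
      (embed 2 0x7543210))))))) ∷ []

certifiedB : Certified edgesB 3
certifiedB = record { sparse = sparseB ; dense = denseB ; exhaust = exhaustion }

-- Tree C: two adjacent vertices of degree 3

edgesC : List (ℕ × ℕ)
edgesC = (1 , 2) ∷ (2 , 3) ∷ (3 , 4) ∷ (4 , 5) ∷ (2 , 6) ∷ (3 , 7) ∷ []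

sparseC denseC : List (ℕ × Certificate)
sparseC =
  (10 , embed 9 0x873625140) ∷
  (8 , split 7 0 (split 9 7 (split 9 0 (split 8 7 (split 8 0 (split 7 5 (split 7 4 (split 9 6
      (embed 0 0x8569074) (split 9 1 (embed 0 0x8519074) (split 8 6 (embed 0 0x9568074) (split 8 3
      (embed 0 0x9538074) (split 5 3 (embed 0 0x4935708) (split 4 2 (embed 0 0x5924708)
      (embed 9 0xa96835421))))))) (split 5 0 (split 5 3 (split 6 0 (embed 0 0x3987506) (split 5 2
      (embed 0 0x9387052) (split 3 1 (embed 0 0x7913508) (embed 9 0xa67452310)))) (split 6 0
      (split 4 0 (split 9 8 (embed 0 0x5698704) (split 9 1 (embed 0 0x8519704) (split 8 6
      (embed 0 0x9568704) (embed 9 0xa98654321)))) (embed 9 0xa47653210)) (embed 9 0xa67453210)))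
      (embed 9 0xa56743210))) (split 6 0 (split 5 0 (split 8 4 (embed 0 0x9648705) (split 8 1
      (embed 0 0x9618705) (split 6 4 (embed 0 0x5946078) (split 5 3 (embed 0 0x6935078)
      (embed 9 0xa84675321))))) (split 7 4 (split 6 4 (split 6 3 (embed 0 0x3974608) (split 4 2
      (embed 0 0x9824706) (embed 9 0xa57634210))) (embed 9 0xa57643210)) (embed 9 0xa56743210)))
      (embed 9 0xa67543210))) (split 8 6 (split 8 5 (split 7 4 (embed 0 0x4690785) (split 5 3
      (embed 0 0x6935870) (split 4 0 (embed 0 0x9640785) (embed 9 0xa47653210)))) (split 7 3
      (split 6 4 (split 9 6 (embed 0 0x0837964) (split 9 5 (embed 0 0x3568790) (split 6 0
      (embed 0 0x9837064) (embed 9 0xa69543210)))) (embed 9 0xa85643210)) (embed 9 0xa85673210)))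
      (embed 9 0xa86543210))) (split 8 1 (split 8 0 (split 8 2 (split 7 5 (embed 0 0x9257081)
      (split 6 0 (embed 0 0x6297081) (embed 9 0xa67543210))) (split 4 0 (split 3 1 (split 8 6
      (embed 0 0x6731804) (split 7 1 (embed 0 0x9831704) (embed 9 0xa78654321)))
      (embed 9 0xa34567821)) (embed 9 0xa45678210))) (split 7 5 (split 6 4 (split 5 3 (split 3 1
      (split 2 0 (split 7 4 (embed 0 0x5964702) (split 5 0 (embed 0 0x7913502)
      (embed 9 0xa56743210))) (embed 9 0xa87654320)) (embed 9 0xa87654310)) (embed 9 0xa87653210))
      (embed 9 0xa87643210)) (embed 9 0xa87543210))) (embed 9 0xa87654321))) (split 9 6 (split 9 5
      (split 7 1 (split 8 6 (embed 0 0x5186970) (split 8 0 (embed 0 0x1680795)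
      (embed 9 0xa86543210))) (split 9 3 (split 2 0 (split 8 7 (embed 0 0x8520793) (split 7 5
      (embed 0 0x5620793) (split 7 3 (embed 0 0x3620795) (split 8 6 (split 8 1 (split 6 0 (split 4 0
      (embed 0 0x9418602) (embed 9 0xa45673210)) (embed 9 0xa67543210)) (embed 9 0xa87654321))
      (embed 9 0xa78654321))))) (embed 9 0xa23456710)) (embed 9 0xa93456710))) (split 7 3 (split 6 4
      (split 9 8 (embed 0 0x8346970) (split 9 2 (embed 0 0x2346970) (split 9 1 (embed 0 0x1346970)
      (split 8 0 (split 6 1 (split 6 0 (embed 0 0x8437061) (embed 9 0xa65432910))
      (embed 9 0xa92345610)) (embed 9 0xa89543210))))) (embed 9 0xa95643210))
      (embed 9 0xa95673210))) (embed 9 0xa96543210))) (split 9 1 (split 9 0 (split 9 4 (split 5 0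
      (split 8 7 (embed 0 0x5487091) (split 8 1 (embed 0 0x4781905) (embed 9 0xa87654321)))
      (split 9 3 (split 7 4 (split 8 4 (embed 0 0x8307491) (split 8 0 (embed 0 0x8347091) (split 6 4
      (embed 0 0x6307491) (split 6 0 (embed 0 0x6347091) (split 4 2 (embed 0 0x2307491) (split 9 5
      (split 8 1 (split 7 3 (split 6 1 (split 5 3 (split 5 1 (embed 0 0x9873516)
      (embed 9 0xa84321560)) (embed 9 0xa84653210)) (embed 9 0xa84321650)) (embed 9 0xa54673210))
      (embed 9 0xa81234650)) (embed 9 0xa67954210))))))) (embed 9 0xa56743210))
      (embed 9 0xa56793210))) (split 6 0 (split 5 1 (split 9 8 (embed 0 0x8751906) (split 9 3
      (embed 0 0x3751906) (split 9 2 (embed 0 0x2751906) (split 8 7 (split 7 1 (split 5 0 (split 4 0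
      (split 3 1 (embed 0 0x8531704) (embed 9 0xa34567921)) (embed 9 0xa45679210))
      (embed 9 0xa56793210)) (embed 9 0xa76549321)) (embed 9 0xa98765432))))) (embed 9 0xa56794321))
      (embed 9 0xa67943210))) (split 9 6 (split 7 5 (split 6 4 (split 5 3 (split 4 2 (split 3 1
      (split 2 0 (split 7 4 (embed 0 0x0635742) (split 6 3 (embed 0 0x9524631) (split 5 2
      (embed 0 0x7413520) (split 3 0 (embed 0 0x5791302) (embed 9 0xa36745210)))))
      (embed 9 0xa97654320)) (embed 9 0xa97654310)) (embed 9 0xa97654210)) (embed 9 0xa97653210))
      (embed 9 0xa97643210)) (embed 9 0xa97543210)) (embed 9 0xa96543210))) (embed 9 0xa97654321)))
      (embed 9 0xa76543210)) ∷
  (7 , split 9 6 (split 9 0 (split 8 6 (split 8 0 (split 7 6 (split 7 0 (split 9 5 (split 7 3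
      (embed 0 0x8659073) (split 6 3 (embed 0 0x5836907) (split 5 2 (embed 0 0x6825907) (split 4 0
      (embed 0 0x5876904) (embed 8 0xa9873652104))))) (split 9 4 (split 6 4 (split 6 0 (split 7 3
      (embed 0 0x4937608) (split 6 3 (embed 0 0x3894607) (split 6 2 (embed 0 0x2894607) (split 5 0
      (embed 0 0x8794605) (split 4 2 (embed 0 0x9824607) (split 4 1 (embed 0 0x9814607)
      (embed 8 0xa9873624105))))))) (embed 8 0xa8795432106)) (embed 8 0xa8795643210))
      (embed 8 0xa8765943210))) (embed 8 0xa9865432107)) (embed 8 0xa9876543210))
      (embed 8 0xa9765432108)) (embed 8 0xa9786543210)) (embed 8 0xa8765432109))
      (embed 8 0xa8796543210)) ∷
  (6 , split 9 0 (split 8 5 (split 7 0 (split 6 5 (split 6 0 (split 6 4 (embed 0 0x4985607)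
      (split 6 3 (embed 0 0x3985607) (embed 7 0xa9875463210))) (embed 7 0xa9875432106))
      (embed 7 0xa9876543210)) (embed 7 0xa9865432107)) (embed 7 0xa9768543210))
      (embed 7 0xa8765432109)) ∷
  (5 , split 9 0 (split 8 4 (split 8 0 (split 7 4 (split 7 0 (split 6 0 (split 5 4 (split 5 0
      (split 6 5 (embed 0 0x6984507) (split 5 3 (embed 0 0x3874506) (embed 6 0xa9874653210)))
      (embed 6 0xa9876432105)) (embed 6 0xa9876543210)) (embed 6 0xa9875432106))
      (embed 6 0xa9865432107)) (embed 6 0xa9865743210)) (embed 6 0xa9765432108))
      (embed 6 0xa9765843210)) (embed 6 0xa8765432109)) ∷
  (4 , split 8 0 (split 7 3 (split 7 0 (split 6 3 (split 6 0 (split 5 0 (split 4 3 (split 4 0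
      (split 5 4 (embed 0 0x5873406) (split 4 2 (embed 0 0x2763405) (embed 5 0xa9876354210)))
      (embed 5 0xa9876532104)) (embed 5 0xa9876543210)) (embed 5 0xa9876432105))
      (embed 5 0xa9875432106)) (embed 5 0xa9875463210)) (embed 5 0xa9865432107))
      (embed 5 0xa9865473210)) (embed 5 0xa9765432108)) ∷
  (3 , split 7 0 (split 6 2 (split 6 0 (split 5 2 (split 5 0 (split 4 0 (split 3 2 (split 3 0
      (split 4 3 (embed 0 0x4762305) (split 3 1 (embed 0 0x1652304) (embed 4 0xa9876524310)))
      (embed 4 0xa9876542103)) (embed 4 0xa9876543210)) (embed 4 0xa9876532104))
      (embed 4 0xa9876432105)) (embed 4 0xa9876435210)) (embed 4 0xa9875432106))
      (embed 4 0xa9875436210)) (embed 4 0xa9865432107)) ∷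
  (2 , split 6 0 (split 5 1 (split 4 0 (split 3 0 (split 2 1 (split 2 0 (split 4 2
      (embed 0 0x4651203) (split 3 2 (embed 0 0x3651204) (embed 3 0xa9876510423)))
      (embed 3 0xa9876543201)) (embed 3 0xa9876543210)) (embed 3 0xa9876542301))
      (embed 3 0xa9876532401)) (embed 3 0xa9876432510)) (embed 3 0xa9875432601)) ∷
  (1 , split 6 1 (split 5 0 (split 4 2 (split 3 0 (split 2 1 (split 1 0 (embed 0 0x6542103)
      (embed 2 0xa9876543210)) (embed 2 0xa9876543021)) (embed 2 0xa9876542130))
      (embed 2 0xa9876531042)) (embed 2 0xa9876432150)) (embed 2 0xa9875432061)) ∷ []
denseC =
  (6 , embed 0 0x3562014) ∷
  (4 , split 6 1 (embed 0 0x5426103) (split 4 1 (embed 0 0x3562014) (split 3 1 (embed 0 0x4562013)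
      (split 2 1 (embed 0 0x5462103) (grow 1 (embed 0 0x3762015)))))) ∷
  (9 , split 6 1 (embed 0 0x6354102) (split 5 1 (embed 0 0x5364102) (split 3 1 (embed 0 0x3620145)
      (split 2 1 (embed 0 0x2630145) (grow 1 (embed 0 0x7354102)))))) ∷
  (3 , split 6 2 (embed 0 0x5426103) (split 5 2 (embed 0 0x6425103) (split 4 2 (embed 0 0x3642015)
      (split 3 2 (embed 0 0x4632015) (split 2 1 (embed 9 0x6514320) (grow 2
      (embed 0 0x3672015))))))) ∷
  (2 , split 5 1 (embed 3 0x6543210) (split 4 1 (embed 3 0x6453210) (split 3 1 (embed 3 0x6354210)
      (split 2 1 (embed 3 0x6254310) (grow 1 (embed 3 0x7643210)))))) ∷
  (5 , split 6 1 (embed 3 0x6543210) (split 4 1 (embed 0 0x4365102) (split 3 1 (embed 0 0x3465102)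
      (split 2 1 (embed 0 0x2465103) (grow 1 (embed 0 0x7365102)))))) ∷
  (1 , split 6 1 (embed 2 0x6543210) (split 5 1 (embed 2 0x5643210) (split 4 1 (embed 2 0x4653210)
      (split 3 1 (embed 2 0x3654210) (split 2 1 (embed 2 0x2654310) (grow 1
      (embed 2 0x7543210))))))) ∷
  (8 , split 6 2 (embed 0 0x5346201) (split 5 4 (embed 9 0x6543210) (split 4 2 (embed 0 0x5364201)
      (split 4 0 (embed 0 0x3652041) (split 4 3 (split 3 2 (embed 0 0x0652341) (split 2 1
      (embed 0 0x0652143) (grow 2 (embed 0 0x3741025)))) (grow 4 (embed 9 0x7643210))))))) ∷
  (7 , split 6 1 (embed 0 0x3652014) (split 5 1 (embed 0 0x2563014) (split 3 1 (embed 8 0x5624301)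
      (split 2 1 (embed 8 0x6534201) (grow 1 (embed 0 0x3752014)))))) ∷
  (10 , split 6 1 (embed 0 0x6354102) (split 5 1 (embed 0 0x4365102) (split 3 1 (embed 8 0x6253041)
      (split 2 1 (embed 8 0x6352041) (grow 1 (embed 0 0x7354102)))))) ∷ []

certifiedC : Certified edgesC 3
certifiedC = record { sparse = sparseC ; dense = denseC ; exhaust = exhaustion }

-- Tree D: the spider with three legs of length 2

edgesD : List (ℕ × ℕ)
edgesD = (1 , 2) ∷ (2 , 3) ∷ (3 , 4) ∷ (4 , 5) ∷ (3 , 6) ∷ (6 , 7) ∷ []

sparseD denseD : List (ℕ × Certificate)
sparseD =
  (10 , embed 9 0x873625140) ∷
  (8 , split 7 0 (split 9 7 (split 9 0 (split 8 7 (split 8 0 (split 7 5 (split 9 6 (split 8 4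
      (embed 0 0x6948075) (split 8 3 (embed 0 0x6938075) (split 8 2 (embed 0 0x6928075) (split 6 4
      (embed 0 0x5746908) (split 6 3 (embed 0 0x5736908) (split 6 1 (embed 0 0x5716908) (split 5 3
      (embed 0 0x6935708) (split 5 1 (embed 0 0x6915708) (split 7 1 (split 5 0 (split 2 0 (split 9 8
      (embed 0 0x6917802) (split 9 5 (embed 0 0x6917502) (split 8 6 (embed 0 0x1796802)
      (embed 9 0xa68954321)))) (embed 9 0xa28463510)) (embed 9 0xa56483210))
      (embed 9 0xa76548321)))))))))) (split 9 4 (split 8 6 (embed 0 0x4968075) (split 8 3
      (embed 0 0x4938075) (split 8 2 (embed 0 0x4928075) (split 8 1 (embed 0 0x4918075) (split 6 4
      (embed 0 0x5764908) (split 5 3 (embed 0 0x4935708) (split 4 2 (embed 0 0x5724908) (split 4 1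
      (embed 0 0x5714908) (split 9 2 (split 7 2 (split 7 1 (split 3 0 (split 2 0 (embed 0 0x4917203)
      (embed 9 0xa28653410)) (embed 9 0xa38654210)) (embed 9 0xa76835421)) (embed 9 0xa83546721))
      (embed 9 0xa83546921)))))))))) (split 5 0 (split 9 3 (split 8 6 (embed 0 0x3968057) (split 8 1
      (embed 0 0x3918057) (split 5 2 (embed 0 0x3987052) (split 3 1 (embed 0 0x8713905)
      (embed 9 0xa86945231))))) (split 7 1 (split 6 0 (split 4 0 (split 5 1 (split 9 8
      (embed 0 0x9851704) (split 9 1 (embed 0 0x8791504) (split 8 6 (embed 0 0x9786051)
      (embed 9 0xa98654321)))) (split 7 3 (split 7 2 (split 2 0 (split 8 6 (split 9 8
      (embed 0 0x6817902) (split 8 5 (embed 0 0x6817502) (split 6 1 (embed 0 0x3716802)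
      (embed 9 0xa69854321)))) (split 8 3 (split 8 2 (embed 0 0x3817204) (embed 9 0xa54396821))
      (embed 9 0xa54968321))) (embed 9 0xa23496510)) (embed 9 0xa54396721)) (embed 9 0xa54967321)))
      (embed 9 0xa45693210)) (embed 9 0xa65493210)) (embed 9 0xa76549321))) (embed 9 0xa56943210))))
      (split 6 0 (split 9 1 (split 8 5 (embed 0 0x1958706) (split 8 4 (embed 0 0x1948706) (split 6 3
      (embed 0 0x1987063) (split 4 1 (embed 0 0x8741906) (embed 9 0xa48576321))))) (split 9 6
      (split 6 1 (split 7 4 (embed 0 0x4716908) (split 5 0 (embed 0 0x8716905)
      (embed 9 0xa56743210))) (split 9 2 (split 2 0 (split 8 5 (embed 0 0x6958702) (split 8 1
      (embed 0 0x6918702) (split 6 4 (embed 0 0x8746029) (embed 9 0xa85764321))))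
      (embed 9 0xa23457610)) (embed 9 0xa92345761))) (embed 9 0xa96754321))) (embed 9 0xa67543210)))
      (split 8 6 (split 7 1 (split 5 1 (embed 0 0x6851709) (split 4 1 (embed 0 0x6841709) (split 3 1
      (embed 0 0x6831709) (split 6 0 (split 9 5 (embed 0 0x5917068) (split 9 2 (embed 0 0x2917068)
      (split 9 8 (split 8 2 (embed 0 0x2817906) (embed 9 0xa82954310)) (embed 9 0xa89543210))))
      (split 8 3 (split 8 2 (split 8 1 (split 7 2 (split 9 2 (embed 0 0x0938271) (split 9 1
      (embed 0 0x0938172) (embed 9 0xa65432910))) (embed 9 0xa67234510)) (embed 9 0xa81234560))
      (embed 9 0xa82341560)) (embed 9 0xa83214560)))))) (split 8 3 (split 2 0 (split 9 6
      (embed 0 0x6938702) (split 9 5 (embed 0 0x5938702) (embed 9 0xa76954321)))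
      (embed 9 0xa23456710)) (embed 9 0xa83456710))) (embed 9 0xa86543210))) (split 8 1 (split 8 0
      (split 6 0 (split 6 4 (embed 0 0x1897064) (split 6 2 (embed 0 0x1897062) (split 7 1 (split 9 5
      (embed 0 0x5981706) (split 9 4 (embed 0 0x4981706) (split 9 3 (embed 0 0x3981706) (split 9 2
      (embed 0 0x2981706) (split 9 8 (split 8 2 (split 3 0 (embed 0 0x2817903)
      (embed 9 0xa39546210)) (embed 9 0xa87659432)) (embed 9 0xa98765432)))))) (split 8 6 (split 8 5
      (split 5 0 (split 2 0 (split 9 6 (embed 0 0x7918602) (split 9 5 (embed 0 0x7918502)
      (embed 9 0xa76954321))) (embed 9 0xa23456710)) (embed 9 0xa54326710)) (embed 9 0xa78564321))
      (embed 9 0xa78654321))))) (split 7 5 (split 9 4 (embed 0 0x4918075) (split 9 3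
      (embed 0 0x3918075) (embed 9 0xa65493210))) (embed 9 0xa67543210))) (split 8 6 (split 7 5
      (split 6 4 (split 5 3 (split 4 2 (split 2 0 (split 7 4 (embed 0 0x5786420) (split 5 0
      (embed 0 0x9735024) (embed 9 0xa56743210))) (embed 9 0xa87654320)) (embed 9 0xa87654210))
      (embed 9 0xa87653210)) (embed 9 0xa87643210)) (embed 9 0xa87543210)) (embed 9 0xa86543210)))
      (embed 9 0xa87654321))) (split 9 6 (split 9 5 (split 8 5 (split 6 4 (embed 0 0x0746958)
      (split 6 2 (embed 0 0x0726958) (split 6 1 (embed 0 0x0716958) (split 9 3 (split 9 2 (split 3 1
      (embed 0 0x0785931) (split 7 5 (split 8 4 (embed 0 0x2948570) (split 8 3 (embed 0 0x2938570)
      (split 6 0 (embed 0 0x2985706) (embed 9 0xa65483210)))) (split 5 0 (split 2 0 (split 8 7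
      (embed 0 0x3978502) (split 8 1 (embed 0 0x3918502) (embed 9 0xa87654321)))
      (embed 9 0xa26754310)) (embed 9 0xa57643210)))) (embed 9 0xa92345610))
      (embed 9 0xa93456210))))) (split 9 8 (split 8 1 (split 6 4 (embed 0 0x1807964) (split 6 3
      (embed 0 0x1807963) (split 6 2 (embed 0 0x1807962) (split 5 3 (embed 0 0x1807953) (split 5 2
      (embed 0 0x1807952) (split 9 4 (split 9 3 (split 8 0 (split 6 1 (embed 0 0x3961807) (split 3 1
      (embed 0 0x4931807) (split 9 2 (split 8 7 (split 6 0 (embed 0 0x2918706) (split 5 0
      (embed 0 0x2918705) (split 2 0 (embed 0 0x3918702) (split 9 1 (split 8 2 (split 7 1
      (embed 0 0x3928170) (embed 9 0xa54326710)) (embed 9 0xa64358210)) (embed 9 0xa91654320)))))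
      (embed 9 0xa67854321)) (embed 9 0xa92654310)))) (embed 9 0xa85643210)) (embed 9 0xa93645210))
      (embed 9 0xa94653210))))))) (split 9 2 (split 8 7 (split 7 4 (split 6 0 (split 8 6
      (embed 0 0x2947860) (split 8 0 (embed 0 0x2947806) (embed 9 0xa86543210))) (split 9 3
      (split 8 2 (split 7 3 (split 4 0 (embed 0 0x2893704) (embed 9 0xa65812340))
      (embed 9 0xa67345810)) (embed 9 0xa65432810)) (embed 9 0xa93218560))) (embed 9 0xa85674321))
      (embed 9 0xa87654321)) (embed 9 0xa92345810))) (embed 9 0xa98543210))) (split 7 3 (split 6 4
      (split 8 3 (split 9 8 (embed 0 0x3807964) (split 9 3 (embed 0 0x0746938) (split 2 0
      (embed 0 0x6983702) (split 8 1 (split 7 1 (split 6 2 (split 6 1 (embed 0 0x3807162)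
      (embed 9 0xa93456120)) (embed 9 0xa93456210)) (embed 9 0xa23456710)) (embed 9 0xa23459810)))))
      (split 8 4 (split 8 2 (split 9 8 (embed 0 0x2807964) (split 4 0 (embed 0 0x2896407)
      (embed 9 0xa45983210))) (embed 9 0xa95438210)) (embed 9 0xa95483210))) (embed 9 0xa95643210))
      (embed 9 0xa95673210))) (embed 9 0xa96543210))) (split 9 1 (split 9 0 (split 9 4 (split 3 1
      (split 8 4 (embed 0 0x8431907) (split 6 4 (embed 0 0x6431907) (split 4 2 (embed 0 0x2431907)
      (split 9 8 (split 8 6 (embed 0 0x6831907) (split 8 5 (embed 0 0x5831907) (split 8 2
      (embed 0 0x2831907) (split 9 3 (split 9 2 (split 7 1 (split 5 0 (split 3 0 (embed 0 0x2971305)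
      (embed 9 0xa34658210)) (embed 9 0xa58643210)) (embed 9 0xa76854321)) (embed 9 0xa97685432))
      (embed 9 0xa85467932))))) (split 8 2 (split 8 0 (split 6 1 (split 6 0 (embed 0 0x4928061)
      (embed 9 0xa67984210)) (embed 9 0xa67984321)) (embed 9 0xa89764210))
      (embed 9 0xa89765432)))))) (split 9 2 (split 8 2 (split 6 4 (embed 0 0x6482907) (split 5 1
      (embed 0 0x8251907) (split 9 3 (split 5 3 (embed 0 0x5382907) (split 2 0 (split 8 6
      (embed 0 0x1968207) (split 8 1 (embed 0 0x3918207) (split 7 5 (embed 0 0x1957028)
      (embed 9 0xa86754321)))) (split 7 2 (split 7 1 (split 8 6 (embed 0 0x1968270) (split 8 0
      (embed 0 0x3928071) (embed 9 0xa86543210))) (embed 9 0xa23546710)) (embed 9 0xa27654310))))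
      (embed 9 0xa54679321)))) (split 9 8 (split 8 7 (split 8 6 (split 6 4 (embed 0 0x1907864)
      (split 6 2 (embed 0 0x1907862) (split 5 1 (embed 0 0x6851907) (split 4 2 (embed 0 0x6842907)
      (split 9 3 (split 8 0 (split 7 3 (embed 0 0x1968073) (split 7 2 (embed 0 0x1968072) (split 7 1
      (embed 0 0x2968071) (split 8 3 (split 8 1 (split 3 0 (split 2 0 (embed 0 0x4918302)
      (embed 9 0xa27654310)) (embed 9 0xa37654210)) (embed 9 0xa82765431)) (embed 9 0xa76543821)))))
      (embed 9 0xa82654310)) (embed 9 0xa54679321)))))) (split 8 0 (split 7 5 (split 2 0
      (embed 0 0x1957802) (embed 9 0xa28654310)) (embed 9 0xa34576821)) (embed 9 0xa86543210)))
      (embed 9 0xa34567821)) (embed 9 0xa89765432))) (embed 9 0xa34567921))) (split 6 0 (split 5 1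
      (split 8 6 (split 9 8 (embed 0 0x6851907) (split 9 6 (embed 0 0x8651907) (split 7 5
      (embed 0 0x1957068) (split 7 3 (embed 0 0x1937068) (split 7 2 (embed 0 0x1927068) (split 8 3
      (split 8 2 (split 4 0 (split 3 1 (split 3 0 (embed 0 0x2851304) (embed 9 0xa34567210))
      (embed 9 0xa34965721)) (embed 9 0xa45673210)) (embed 9 0xa89765432))
      (embed 9 0xa76549832))))))) (split 8 1 (split 8 0 (split 8 2 (split 9 8 (embed 0 0x2851906)
      (split 7 2 (embed 0 0x7251806) (embed 9 0xa79865432))) (split 9 8 (split 7 5 (split 3 1
      (split 3 0 (embed 0 0x9857031) (embed 9 0xa34568210)) (embed 9 0xa34976821))
      (embed 9 0xa86579432)) (embed 9 0xa89765432))) (embed 9 0xa86543210)) (embed 9 0xa86794321)))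
      (embed 9 0xa56794321)) (embed 9 0xa67943210))) (split 9 6 (split 7 5 (split 6 4 (split 5 3
      (split 4 2 (split 3 1 (split 2 0 (split 7 4 (embed 0 0x5796420) (split 6 3 (embed 0 0x4675319)
      (split 5 2 (embed 0 0x3564207) (split 3 0 (embed 0 0x5713024) (embed 9 0xa36745210)))))
      (embed 9 0xa97654320)) (embed 9 0xa97654310)) (embed 9 0xa97654210)) (embed 9 0xa97653210))
      (embed 9 0xa97643210)) (embed 9 0xa97543210)) (embed 9 0xa96543210))) (embed 9 0xa97654321)))
      (embed 9 0xa76543210)) ∷
  (7 , split 9 0 (split 8 6 (split 8 0 (split 7 6 (split 7 0 (split 9 5 (split 7 4
      (embed 0 0x5968074) (split 7 3 (embed 0 0x5968073) (embed 8 0xa9865473210))) (split 9 8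
      (split 9 7 (split 9 4 (split 6 4 (split 6 0 (split 7 3 (embed 0 0x9837064) (split 6 3
      (embed 0 0x4936708) (split 6 2 (embed 0 0x4926708) (split 5 0 (embed 0 0x8946705) (split 4 2
      (embed 0 0x9724608) (split 4 1 (embed 0 0x9714608) (embed 8 0xa9873624105)))))))
      (embed 8 0xa8795432106)) (embed 8 0xa8795643210)) (embed 8 0xa8765943210))
      (embed 8 0xa8679543210)) (embed 8 0xa7689543210))) (embed 8 0xa9865432107))
      (embed 8 0xa9876543210)) (embed 8 0xa9765432108)) (embed 8 0xa9786543210))
      (embed 8 0xa8765432109)) ∷
  (6 , split 9 0 (split 8 5 (split 8 0 (split 7 0 (split 6 5 (split 6 0 (split 9 4 (split 7 6
      (embed 0 0x4958067) (split 6 4 (embed 0 0x8594607) (embed 7 0xa9857643210))) (split 9 8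
      (split 9 6 (split 5 3 (embed 0 0x8935607) (embed 7 0xa8769453210)) (embed 7 0xa8756943210))
      (embed 7 0xa7658943210))) (embed 7 0xa9875432106)) (embed 7 0xa9876543210))
      (embed 7 0xa9865432107)) (embed 7 0xa9765432108)) (embed 7 0xa9768543210))
      (embed 7 0xa8765432109)) ∷
  (5 , split 9 0 (split 7 4 (split 7 0 (split 6 0 (split 5 4 (split 5 0 (split 9 3 (split 6 5
      (embed 0 0x3947056) (split 5 3 (embed 0 0x7493506) (embed 6 0xa9874653210))) (split 9 7
      (split 9 5 (split 4 2 (embed 0 0x7924506) (embed 6 0xa8765934210)) (embed 6 0xa8764593210))
      (embed 6 0xa8654793210))) (embed 6 0xa9876432105)) (embed 6 0xa9876543210))
      (embed 6 0xa9875432106)) (embed 6 0xa9865432107)) (embed 6 0xa9865743210))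
      (embed 6 0xa8765432109)) ∷
  (4 , split 9 0 (split 6 3 (split 6 0 (split 5 0 (split 4 3 (split 4 0 (split 9 2 (split 5 4
      (embed 0 0x2936045) (split 4 2 (embed 0 0x6392405) (embed 5 0xa9876354210))) (split 9 6
      (split 9 4 (split 3 1 (embed 0 0x6913405) (embed 5 0xa8765492310)) (embed 5 0xa8765349210))
      (embed 5 0xa8754369210))) (embed 5 0xa9876532104)) (embed 5 0xa9876543210))
      (embed 5 0xa9876432105)) (embed 5 0xa9875432106)) (embed 5 0xa9875463210))
      (embed 5 0xa8765432109)) ∷
  (3 , split 9 0 (split 5 2 (split 5 0 (split 4 0 (split 3 2 (split 3 0 (split 9 1 (split 4 3
      (embed 0 0x1925034) (split 3 1 (embed 0 0x5291304) (embed 4 0xa9876524310))) (split 9 6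
      (split 9 3 (embed 0 0x6952304) (embed 4 0xa8765423910)) (embed 4 0xa8754326910)))
      (embed 4 0xa9876542103)) (embed 4 0xa9876543210)) (embed 4 0xa9876532104))
      (embed 4 0xa9876432105)) (embed 4 0xa9876435210)) (embed 4 0xa8765432109)) ∷
  (2 , split 8 0 (split 4 1 (split 4 0 (split 3 1 (split 3 0 (split 2 1 (split 2 0 (split 9 8
      (split 4 2 (embed 0 0x9813024) (split 3 2 (embed 0 0x9814023) (embed 3 0xa9876510423)))
      (split 9 4 (split 8 3 (embed 0 0x9483021) (embed 3 0xa7654210983)) (embed 3 0xa7653210894)))
      (embed 3 0xa9876543201)) (embed 3 0xa9876543210)) (embed 3 0xa9876542301))
      (embed 3 0xa9876542310)) (embed 3 0xa9876532401)) (embed 3 0xa9876532410))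
      (embed 3 0xa9765432801)) ∷
  (1 , split 6 3 (split 5 2 (split 4 1 (split 3 0 (split 2 0 (split 1 0 (embed 0 0x6352014)
      (embed 2 0xa9876543210)) (embed 2 0xa9876543120)) (embed 2 0xa9876542130))
      (embed 2 0xa9876532041)) (embed 2 0xa9876431052)) (embed 2 0xa9875421063)) ∷ []
denseD =
  (7 , embed 0 0x6352014) ∷
  (8 , split 6 3 (embed 0 0x6352014) (split 5 1 (embed 0 0x2564103) (split 2 1 (embed 0 0x6452103)
      (split 3 1 (split 6 0 (embed 0 0x4652013) (split 5 3 (embed 0 0x6453102) (split 4 0
      (embed 0 0x6452013) (split 3 2 (split 5 0 (embed 0 0x6423105) (grow 0 (embed 0 0x6423107)))
      (split 3 4 (split 6 1 (embed 0 0x4352016) (grow 1 (embed 0 0x4352017))) (grow 3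
      (embed 0 0x7352014))))))) (split 3 2 (split 4 3 (embed 0 0x6452301) (split 3 5 (split 6 2
      (embed 0 0x5362014) (split 4 2 (embed 0 0x6453201) (grow 2 (embed 0 0x5372014)))) (grow 3
      (embed 0 0x7352014)))) (split 3 4 (split 6 1 (embed 0 0x4352016) (grow 1 (embed 0 0x4352017)))
      (split 3 5 (split 6 2 (embed 0 0x5362014) (split 4 2 (embed 0 0x3564201) (grow 2
      (embed 0 0x5372014)))) (grow 3 (embed 0 0x7352014))))))))) ∷
  (4 , split 6 3 (embed 8 0x3564120) (split 5 3 (embed 8 0x3654210) (split 4 3 (embed 0 0x4362015)
      (split 3 2 (embed 8 0x6524130) (split 3 1 (embed 8 0x5614230) (grow 3
      (embed 0 0x7362015))))))) ∷
  (6 , split 6 4 (embed 8 0x4563120) (split 5 4 (embed 8 0x5643210) (split 4 3 (embed 0 0x4362015)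
      (split 4 2 (embed 8 0x6325041) (split 4 0 (embed 8 0x5613240) (grow 4
      (embed 8 0x7643210))))))) ∷
  (9 , split 6 1 (embed 6 0x5326401) (split 5 1 (embed 6 0x6325401) (split 3 1 (embed 6 0x2653041)
      (split 2 1 (embed 6 0x3652041) (grow 1 (embed 6 0x5327401)))))) ∷
  (10 , split 6 1 (embed 6 0x5326401) (split 5 1 (embed 6 0x6324501) (split 3 1 (embed 8 0x6253041)
      (split 2 1 (embed 8 0x6352041) (grow 1 (embed 8 0x6257041)))))) ∷
  (3 , split 6 2 (embed 4 0x6543210) (split 5 2 (embed 4 0x5643210) (split 4 2 (embed 6 0x4653210)
      (split 3 2 (embed 6 0x3654210) (split 2 1 (embed 9 0x6514320) (grow 2
      (embed 4 0x7543210))))))) ∷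
  (2 , split 5 1 (embed 3 0x6543210) (split 4 1 (embed 3 0x6453210) (split 3 1 (embed 3 0x6354210)
      (split 2 1 (embed 3 0x6254310) (grow 1 (embed 3 0x7643210)))))) ∷
  (5 , split 6 1 (embed 3 0x6543210) (split 4 1 (embed 6 0x6324501) (split 3 1 (embed 6 0x6423501)
      (split 2 1 (embed 6 0x6432501) (grow 1 (embed 6 0x6327501)))))) ∷
  (1 , split 6 1 (embed 2 0x6543210) (split 5 1 (embed 2 0x5643210) (split 4 1 (embed 2 0x4653210)
      (split 3 1 (embed 2 0x3654210) (split 2 1 (embed 2 0x2654310) (grow 1
      (embed 2 0x7543210))))))) ∷ []

certifiedD : Certified edgesD 4
certifiedD = record { sparse = sparseD ; dense = denseD ; exhaust = exhaustion }

-- Tree E: two vertices of degree 3 at distance 2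

edgesE : List (ℕ × ℕ)
edgesE = (1 , 2) ∷ (2 , 3) ∷ (3 , 4) ∷ (4 , 5) ∷ (2 , 6) ∷ (4 , 7) ∷ []

sparseE denseE : List (ℕ × Certificate)
sparseE =
  (10 , embed 9 0x873625140) ∷
  (8 , split 7 0 (split 9 7 (split 9 0 (split 8 7 (split 8 0 (split 7 5 (split 4 0 (split 7 3
      (embed 0 0x5937804) (split 7 2 (embed 0 0x5927804) (split 6 0 (embed 0 0x9657804)
      (embed 9 0xa65437210)))) (split 7 3 (split 6 0 (embed 0 0x5937806) (split 2 0
      (embed 0 0x5937802) (split 7 1 (split 3 0 (embed 0 0x5917308) (split 7 2 (split 9 1 (split 9 6
      (embed 0 0x6319072) (split 9 5 (embed 0 0x5319072) (embed 9 0xa69543210))) (split 9 4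
      (split 9 2 (embed 0 0x4329071) (embed 9 0xa65432910)) (embed 9 0xa65491230)))
      (embed 9 0xa34567210))) (embed 9 0xa23456710)))) (embed 9 0xa45673210))) (split 6 0 (split 7 1
      (split 7 4 (embed 0 0x4917806) (split 5 0 (embed 0 0x9617805) (embed 9 0xa56743210)))
      (split 2 0 (split 7 4 (embed 0 0x9647802) (split 7 3 (embed 0 0x9637802) (split 5 0 (split 4 0
      (split 7 2 (embed 0 0x9587204) (split 3 0 (split 9 6 (split 9 5 (embed 0 0x7369502) (split 9 1
      (embed 0 0x7319602) (embed 9 0xa95674321))) (split 9 5 (split 9 2 (split 9 1
      (embed 0 0x5419203) (embed 9 0xa96754321)) (embed 9 0xa73456921)) (embed 9 0xa76954321)))
      (embed 9 0xa34567210))) (embed 9 0xa45673210)) (embed 9 0xa56743210))))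
      (embed 9 0xa23456710))) (embed 9 0xa67543210))) (split 8 6 (split 8 5 (split 9 4
      (embed 0 0x4609785) (split 9 3 (embed 0 0x3609785) (split 9 2 (embed 0 0x2609785) (split 4 0
      (embed 0 0x6958704) (split 3 0 (embed 0 0x6958703) (split 2 0 (embed 0 0x6958702) (split 7 2
      (split 6 3 (split 6 1 (split 6 0 (embed 0 0x8327061) (embed 9 0xa65493210))
      (embed 9 0xa29345610)) (embed 9 0xa45639210)) (embed 9 0xa34567210)))))))) (split 7 3
      (split 6 4 (split 6 3 (embed 0 0x9807364) (split 6 2 (embed 0 0x3407862)
      (embed 9 0xa85436210))) (embed 9 0xa85643210)) (embed 9 0xa85673210))) (embed 9 0xa86543210)))
      (split 8 1 (split 8 0 (split 8 4 (split 9 6 (embed 0 0x7469081) (split 9 5 (embed 0 0x7459081)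
      (split 9 3 (embed 0 0x7439081) (split 7 5 (embed 0 0x4918075) (split 7 3 (embed 0 0x4918073)
      (split 7 2 (embed 0 0x4918072) (split 7 1 (split 6 0 (split 5 1 (split 4 0 (split 3 1
      (split 3 0 (embed 0 0x7651304) (embed 9 0xa39657210)) (embed 9 0xa34596721))
      (embed 9 0xa45673210)) (embed 9 0xa54396721)) (embed 9 0xa67543210))
      (embed 9 0xa76954321)))))))) (split 6 0 (split 5 1 (split 6 1 (embed 0 0x8951607) (split 3 1
      (embed 0 0x5731806) (split 5 3 (split 5 2 (split 2 0 (embed 0 0x3715206)
      (embed 9 0xa23487610)) (embed 9 0xa34876521)) (embed 9 0xa67845321)))) (embed 9 0xa56784321))
      (embed 9 0xa67843210))) (split 8 6 (split 7 5 (split 6 4 (split 5 3 (split 4 2 (split 2 0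
      (split 8 5 (embed 0 0x8935702) (split 8 4 (embed 0 0x8964207) (split 6 0 (embed 0 0x9857064)
      (embed 9 0xa65843210)))) (embed 9 0xa87654320)) (embed 9 0xa87654210)) (embed 9 0xa87653210))
      (embed 9 0xa87643210)) (embed 9 0xa87543210)) (embed 9 0xa86543210))) (embed 9 0xa87654321)))
      (split 9 6 (split 9 5 (split 8 0 (split 4 0 (embed 0 0x6859704) (split 3 0 (embed 0 0x6859703)
      (split 2 0 (embed 0 0x6859702) (split 7 3 (split 7 2 (split 7 1 (split 9 3 (embed 0 0x6159370)
      (split 9 2 (embed 0 0x6159270) (split 6 3 (split 6 1 (split 6 0 (embed 0 0x9327061)
      (embed 9 0xa65439210)) (embed 9 0xa92345610)) (embed 9 0xa45639210)))) (embed 9 0xa23456710))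
      (embed 9 0xa34567210)) (embed 9 0xa45673210))))) (split 8 6 (split 7 2 (split 6 4
      (embed 0 0x2807964) (split 6 3 (embed 0 0x2807963) (split 6 1 (embed 0 0x2807961) (split 8 5
      (split 8 4 (split 8 2 (embed 0 0x5948270) (embed 9 0xa82345610)) (embed 9 0xa84563210))
      (embed 9 0xa85643210))))) (split 9 4 (split 8 4 (split 3 0 (split 8 3 (embed 0 0x7659483)
      (split 8 2 (embed 0 0x7659482) (split 6 0 (embed 0 0x5749603) (embed 9 0xa65438210))))
      (embed 9 0xa34567210)) (embed 9 0xa84567210)) (embed 9 0xa94567210))) (embed 9 0xa86543210)))
      (split 7 3 (split 6 4 (split 6 2 (embed 0 0x3407962) (split 6 1 (embed 0 0x3407961)
      (embed 9 0xa95432610))) (embed 9 0xa95643210)) (embed 9 0xa95673210))) (embed 9 0xa96543210)))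
      (split 9 1 (split 9 0 (split 9 4 (split 8 7 (split 7 5 (embed 0 0x4819075) (split 7 3
      (embed 0 0x4819073) (split 7 2 (embed 0 0x4819072) (split 6 0 (split 4 0 (split 3 0 (split 9 6
      (embed 0 0x6719403) (split 9 5 (embed 0 0x5619403) (split 9 3 (embed 0 0x4719306) (split 7 1
      (split 5 1 (split 3 1 (embed 0 0x7651304) (embed 9 0xa34596721)) (embed 9 0xa54396721))
      (embed 9 0xa79654321))))) (embed 9 0xa34567210)) (embed 9 0xa45673210))
      (embed 9 0xa67543210))))) (split 8 1 (split 3 1 (split 5 0 (embed 0 0x8731905) (split 4 0
      (embed 0 0x8731904) (split 7 4 (split 7 3 (embed 0 0x4907318) (embed 9 0xa45673210))
      (embed 9 0xa56743210)))) (split 9 2 (split 8 0 (split 8 6 (embed 0 0x4629081) (split 8 3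
      (embed 0 0x4329081) (split 4 0 (embed 0 0x2819407) (embed 9 0xa45683210))))
      (embed 9 0xa87654310)) (embed 9 0xa34567921))) (embed 9 0xa87654321))) (split 6 0 (split 5 1
      (split 8 1 (embed 0 0x8751906) (split 4 1 (embed 0 0x5741906) (split 3 1 (embed 0 0x5731906)
      (split 9 8 (split 9 2 (split 5 3 (split 5 0 (embed 0 0x8329051) (embed 9 0xa56794310))
      (embed 9 0xa49765321)) (embed 9 0xa34567921)) (embed 9 0xa89765431))))) (embed 9 0xa56794321))
      (embed 9 0xa67943210))) (split 9 6 (split 7 5 (split 6 4 (split 5 3 (split 4 2 (split 3 1
      (split 2 0 (split 9 4 (split 7 4 (embed 0 0x6519470) (split 5 0 (embed 0 0x9764205)
      (embed 9 0xa56743210))) (split 6 3 (split 6 0 (embed 0 0x5713602) (embed 9 0xa67943210))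
      (embed 9 0xa94563210))) (embed 9 0xa97654320)) (embed 9 0xa97654310)) (embed 9 0xa97654210))
      (embed 9 0xa97653210)) (embed 9 0xa97643210)) (embed 9 0xa97543210)) (embed 9 0xa96543210)))
      (embed 9 0xa97654321))) (embed 9 0xa76543210)) ∷
  (7 , split 9 6 (split 9 0 (split 8 0 (split 7 6 (split 7 0 (split 6 1 (split 6 4
      (embed 0 0x4916708) (split 6 2 (embed 0 0x2916708) (split 5 0 (embed 0 0x9816705) (split 3 0
      (embed 0 0x9816703) (split 9 1 (split 8 1 (split 7 2 (embed 0 0x2907618)
      (embed 8 0xa9872654301)) (embed 8 0xa9781264305)) (embed 8 0xa8791264305)))))) (split 9 2
      (split 7 2 (split 9 4 (split 7 5 (embed 0 0x6549072) (split 6 0 (embed 0 0x4829607)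
      (embed 8 0xa9875432106))) (split 8 5 (split 7 5 (split 6 0 (split 5 2 (split 3 0 (split 2 0
      (embed 0 0x8675203) (embed 8 0xa8794561023)) (embed 8 0xa8794561032)) (embed 8 0xa8794325610))
      (embed 8 0xa8794560123)) (embed 8 0xa8075612349)) (embed 8 0xa7085612349)))
      (embed 8 0xa9872345610)) (embed 8 0xa8792345610))) (embed 8 0xa9865432107))
      (embed 8 0xa9876543210)) (embed 8 0xa9765432108)) (embed 8 0xa8765432109))
      (embed 8 0xa8796543210)) ∷
  (6 , split 9 5 (split 8 0 (split 7 5 (split 7 0 (split 6 5 (split 6 0 (split 5 3
      (embed 0 0x9835607) (split 5 2 (embed 0 0x9825607) (split 5 1 (embed 0 0x9815607) (split 4 0
      (embed 0 0x9875604) (split 3 0 (embed 0 0x9875603) (split 2 0 (embed 0 0x9875602) (split 7 4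
      (split 7 2 (split 6 3 (split 6 1 (embed 0 0x4327061) (embed 7 0xa9876153204))
      (embed 7 0xa9876352104)) (embed 7 0xa9867235104)) (embed 7 0xa9867452103))))))))
      (embed 7 0xa9875432106)) (embed 7 0xa9876543210)) (embed 7 0xa9865432107))
      (embed 7 0xa9867543210)) (embed 7 0xa9765432108)) (embed 7 0xa8769543210)) ∷
  (5 , split 9 4 (split 8 0 (split 7 4 (split 6 0 (split 5 4 (split 5 0 (embed 0 0x9874506)
      (embed 6 0xa9876432105)) (embed 6 0xa9876543210)) (embed 6 0xa9875432106))
      (embed 6 0xa9865743210)) (embed 6 0xa9765432108)) (embed 6 0xa8765943210)) ∷
  (4 , split 8 3 (split 7 0 (split 6 3 (split 5 0 (split 4 3 (split 4 0 (embed 0 0x8763405)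
      (embed 5 0xa9876532104)) (embed 5 0xa9876543210)) (embed 5 0xa9876432105))
      (embed 5 0xa9875463210)) (embed 5 0xa9865432107)) (embed 5 0xa9765483210)) ∷
  (3 , split 7 2 (split 6 0 (split 5 2 (split 4 0 (split 3 2 (split 3 0 (embed 0 0x7652304)
      (embed 4 0xa9876542103)) (embed 4 0xa9876543210)) (embed 4 0xa9876532104))
      (embed 4 0xa9876435210)) (embed 4 0xa9875432106)) (embed 4 0xa9865437210)) ∷
  (2 , split 6 1 (split 5 0 (split 4 1 (split 3 0 (split 2 1 (split 2 0 (embed 0 0x6541203)
      (embed 3 0xa9876543201)) (embed 3 0xa9876543210)) (embed 3 0xa9876542301))
      (embed 3 0xa9876532410)) (embed 3 0xa9876432501)) (embed 3 0xa9875432610)) ∷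
  (1 , split 6 2 (split 5 0 (split 4 2 (split 3 0 (split 2 1 (split 1 0 (embed 0 0x6542103)
      (embed 2 0xa9876543210)) (embed 2 0xa9876543021)) (embed 2 0xa9876542130))
      (embed 2 0xa9876531042)) (embed 2 0xa9876432150)) (embed 2 0xa9875431062)) ∷ []
denseE =
  (9 , embed 0 0x6354102) ∷
  (5 , split 5 4 (embed 0 0x6345102) (split 5 3 (embed 0 0x6435102) (split 5 2 (embed 0 0x6425103)
      (split 5 0 (grow 5 (embed 0 0x7365102)) (grow 5 (embed 0 0x7365102)))))) ∷
  (10 , split 6 0 (embed 5 0x5463210) (split 4 0 (embed 5 0x6532140) (split 0 5 (grow 0
      (embed 5 0x5473210)) (grow 0 (embed 5 0x5473210))))) ∷
  (3 , split 6 5 (embed 5 0x6543210) (split 5 4 (embed 10 0x6153240) (split 5 3 (embed 10 0x6154230)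
      (split 5 2 (embed 10 0x6154320) (split 5 0 (embed 5 0x6143250) (grow 5
      (embed 5 0x7543210))))))) ∷
  (2 , split 5 1 (embed 5 0x6143250) (split 4 1 (embed 5 0x6153240) (split 3 1 (embed 5 0x6154230)
      (split 2 1 (embed 5 0x6154320) (grow 1 (embed 3 0x7643210)))))) ∷
  (4 , split 6 0 (embed 2 0x5643210) (split 5 0 (embed 2 0x6543120) (grow 0 (embed 2 0x5743210)))) ∷
  (6 , split 6 0 (embed 3 0x5463210) (split 5 0 (embed 4 0x6453210) (split 4 0 (embed 4 0x6543210)
      (grow 0 (embed 3 0x5473210))))) ∷
  (7 , split 6 0 (embed 4 0x5463210) (split 5 0 (embed 4 0x6452310) (split 4 0 (embed 4 0x6541320)
      (grow 0 (embed 4 0x5473210))))) ∷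
  (8 , split 6 0 (embed 4 0x5463210) (split 5 0 (embed 5 0x6453210) (split 4 0 (embed 4 0x6531420)
      (grow 0 (embed 5 0x6473210))))) ∷
  (1 , split 6 1 (embed 2 0x6543210) (split 5 1 (embed 2 0x5643210) (split 4 1 (embed 2 0x4653210)
      (split 3 1 (embed 2 0x3654210) (split 2 1 (embed 2 0x2654310) (grow 1
      (embed 2 0x7543210))))))) ∷ []

certifiedE : Certified edgesE 5
certifiedE = record { sparse = sparseE ; dense = denseE ; exhaust = exhaustion }

theorem5 : RamseyNumberIs treeA wheel8 13 × RamseyNumberIs treeB wheel8 13
    × RamseyNumberIs treeC wheel8 13 × RamseyNumberIs treeD wheel8 14
    × RamseyNumberIs treeE wheel8 15
theorem5 =
  (upper treeA edgesA (λ _ _ → refl) certifiedA ≤-refl , 2K₆-excludes treeA _) ,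
  (upper treeB edgesB (λ _ _ → refl) certifiedB ≤-refl , 2K₆-excludes treeB _) ,
  (upper treeC edgesC (λ _ _ → refl) certifiedC ≤-refl , 2K₆-excludes treeC _) ,
  (upper treeD edgesD (λ _ _ → refl) certifiedD (n≤1+n 3) ,
    -- Colour 4 is the single vertex shared by the two K₄.
    lower ((1 , 1) ∷ (2 , 2) ∷ (3 , 3) ∷ (2 , 4) ∷ (3 , 4) ∷ []) treeD wheel8 κ₁₃ _ _) ,
  (upper treeE edgesE (λ _ _ → refl) certifiedE (m≤m+n 3 2) ,
    -- Colours 2 and 3 are the sides of K₄,₄.
    lower ((1 , 1) ∷ (2 , 3) ∷ []) treeE wheel8 κ₁₄ _ _)
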